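{- For each positive integer $r$ there is a constant $c_r$ such that if $n \ge k \ge 2$ are integers, then $$h(n, k, W_{2r+1}) \le c_r \frac{n^2}{k^{2 - 1/(r+1)}}.$$
   Context: All graphs are finite, undirected and simple. A graph is $H$-free if it does not contain $H$ as a (not necessarily induced) subgraph. For a graph $G$ and a positive integer $k$, $h(G,k)$ is the minimum number of edges that can be deleted from $G$ so that the remaining graph is $k$-colorable. For a graph $H$ and positive integers $n,k$, $h(n,k,H)$ is the maximum of $h(G,k)$ over all $H$-free graphs $G$ on $n$ vertices. The wheel $W_\ell$ is the graph on $\ell+1$ vertices consisting of an $\ell$-cycle and an additional vertex adjacent to all vertices of the $\ell$-cycle. -}

module Defs where

open import Data.Bool using (Bool; true; false; T; T?; not; _∧_; _∨_; if_then_else_)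
open import Data.Bool.Properties using (∨-comm; ∨-idem)
open import Data.Fin using (Fin; zero; suc; toℕ; _≟_; combine; remQuot; finToFun; funToFin)
open import Data.Fin.Properties using (any?; all?; finToFun-funToFin; remQuot-combine)
open import Data.Fin.Subset using (Subset)
open import Data.Fin.Subset.Properties using (anySubset?)
open import Data.Nat using (ℕ; zero; suc; _+_; _*_; _≤_; _<ᵇ_; _≡ᵇ_; z≤n; NonZero)
open import Data.Nat.Properties
  using (+-0-commutativeMonoid; ≤-refl; ≤-trans; ≤-reflexive; ≤-antisym; +-mono-≤; +-suc; +-identityʳ;
         *-identityʳ; m≤n⇒m<n∨m≡n; ≤-pred; n≤0⇒n≡0)
  renaming (_≟_ to _≟ℕ_)
open import Data.Product using (∃; _×_; _,_; proj₁; proj₂; uncurry)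
open import Data.Sum using (inj₁; inj₂)
open import Data.Vec using (lookup; tabulate)
open import Data.Vec.Properties using (lookup∘tabulate)
open import Function using (_∘_; Injective)
open import Relation.Binary.PropositionalEquality
open import Relation.Nullary using (Dec; yes; no; ¬_; does; contradiction)
open import Relation.Nullary.Decidable using (map′; _×-dec_; _→-dec_; ¬?; dec-true; dec-false)
open import Relation.Unary using (Decidable)

open import Algebra.Properties.CommutativeMonoid.Sum +-0-commutativeMonoid
  using (sum-syntax; sum; sum-cong-≗)

record Graph (n : ℕ) : Set where
  field
    adj        : Fin n → Fin n → Bool
    adj-sym    : ∀ u v → adj u v ≡ adj v u
    adj-irrefl : ∀ v → adj v v ≡ false

open Graph public

-- The simple graph generated by an arbitrary relation: symmetrise it and drop the loops.
fromRel : ∀ {n} → (Fin n → Fin n → Bool) → Graph n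
fromRel R = record
  { adj        = λ u v → not (does (u ≟ v)) ∧ (R u v ∨ R v u)
  ; adj-sym    = λ u v → cong₂ _∧_ (cong not (≟-sym u v)) (∨-comm (R u v) (R v u))
  ; adj-irrefl = λ v → cong (λ b → not b ∧ (R v v ∨ R v v)) (dec-true (v ≟ v) refl)
  }
  where
  ≟-sym : ∀ {n} (u v : Fin n) → does (u ≟ v) ≡ does (v ≟ u)
  ≟-sym u v with u ≟ v
  ... | yes u≡v = sym (dec-true (v ≟ u) (sym u≡v))
  ... | no  u≢v = sym (dec-false (v ≟ u) (u≢v ∘ sym))

-- Vertex zero is the hub and suc i is the i-th rim vertex. For ℓ ≥ 3 this is the usual
-- wheel; smaller ℓ give degenerate graphs.
wheel : ∀ ℓ → Graph (suc ℓ)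
wheel ℓ = fromRel R
  where
  R : Fin (suc ℓ) → Fin (suc ℓ) → Bool
  R zero    _       = true
  R (suc _) zero    = false
  R (suc i) (suc j) = (suc (toℕ i) ≡ᵇ toℕ j) ∨ ((suc (toℕ i) ≡ᵇ ℓ) ∧ (toℕ j ≡ᵇ 0))

_Contains_ : ∀ {n m} → Graph n → Graph m → Set
_Contains_ {n} {m} G H = ∃ λ (f : Fin m → Fin n) →
  Injective _≡_ _≡_ f × (∀ u v → T (adj H u v) → T (adj G (f u) (f v)))

_Free_ : ∀ {n m} → Graph m → Graph n → Set
H Free G = ¬ (G Contains H)

Colorable : ∀ {n} → ℕ → Graph n → Set
Colorable {n} k G = ∃ λ (c : Fin n → Fin k) → ∀ u v → T (adj G u v) → c u ≢ c v

_⊆_ : ∀ {n} → Graph n → Graph n → Set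
F ⊆ G = ∀ u v → T (adj F u v) → T (adj G u v)

_─_ : ∀ {n} → Graph n → Graph n → Graph n
G ─ F = record
  { adj        = λ u v → adj G u v ∧ not (adj F u v)
  ; adj-sym    = λ u v → cong₂ (λ a b → a ∧ not b) (adj-sym G u v) (adj-sym F u v)
  ; adj-irrefl = λ v → cong (_∧ not (adj F v v)) (adj-irrefl G v)
  }

edgeCount : ∀ {n} → Graph n → ℕ
edgeCount {n} G =
  ∑[ u < n ] ∑[ v < n ] (if (toℕ u <ᵇ toℕ v) ∧ adj G u v then 1 else 0)

IsMinimum : (ℕ → Set) → ℕ → Set
IsMinimum P m = P m × (∀ j → P j → m ≤ j)

IsMaximum : (ℕ → Set) → ℕ → Set
IsMaximum P m = P m × (∀ j → P j → j ≤ m)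

-- The deleted edges are recorded as a spanning subgraph F of G.
DeletableTo : ∀ {n} → Graph n → ℕ → ℕ → Set
DeletableTo {n} G k j =
  ∃ λ (F : Graph n) → F ⊆ G × edgeCount F ≡ j × Colorable k (G ─ F)

-- Is-h G k m says that h(G,k) = m, and Is-hₙ n k H m says that h(n,k,H) = m.
Is-h : ∀ {n} → Graph n → ℕ → ℕ → Set
Is-h G k = IsMinimum (DeletableTo G k)

Is-hₙ : ∀ {m} → ℕ → ℕ → Graph m → ℕ → Set
Is-hₙ n k H = IsMaximum (λ j → ∃ λ (G : Graph n) → H Free G × Is-h G k j)

-- The rest shows that these values exist and are unique whenever k is positive and, for
-- Is-hₙ, H has an edge (so that some graph is H-free); see Is-h-exists, Is-hₙ-exists and
-- the two uniqueness lemmas below.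

IsMinimum-unique : ∀ {P a b} → IsMinimum P a → IsMinimum P b → a ≡ b
IsMinimum-unique (pa , la) (pb , lb) = ≤-antisym (la _ pb) (lb _ pa)

IsMaximum-unique : ∀ {P a b} → IsMaximum P a → IsMaximum P b → a ≡ b
IsMaximum-unique (pa , ua) (pb , ub) = ≤-antisym (ub _ pa) (ua _ pb)

minimum : ∀ {P : ℕ → Set} → Decidable P → ∃ P → ∃ (IsMinimum P)
minimum {P} P? (m , pm) = go m 0 (λ _ _ → z≤n) (subst P (sym (+-identityʳ m)) pm)
  where
  go : ∀ d b → (∀ j → P j → b ≤ j) → P (d + b) → ∃ (IsMinimum P)
  go zero    b lb p = b , p , lb
  go (suc d) b lb p with P? b
  ... | yes pb = b , pb , lb
  ... | no ¬pb = go d (suc b) lb′ (subst P (sym (+-suc d b)) p)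
    where
    lb′ : ∀ j → P j → suc b ≤ j
    lb′ j pj with m≤n⇒m<n∨m≡n (lb j pj)
    ... | inj₁ b<j  = b<j
    ... | inj₂ refl = contradiction pj ¬pb

maximum : ∀ {P : ℕ → Set} → Decidable P → ∃ P → ∀ b → (∀ j → P j → j ≤ b) → ∃ (IsMaximum P)
maximum {P} P? (m , pm) zero ub = 0 , subst P (n≤0⇒n≡0 (ub m pm)) pm , ub
maximum {P} P? (m , pm) (suc b) ub with P? (suc b)
... | yes p = suc b , p , ub
... | no ¬p = maximum P? (m , pm) b ub′
  where
  ub′ : ∀ j → P j → j ≤ b
  ub′ j pj with m≤n⇒m<n∨m≡n (ub j pj)
  ... | inj₁ j<1+b = ≤-pred j<1+b
  ... | inj₂ refl  = contradiction pj ¬p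

_≈_ : ∀ {n} → Graph n → Graph n → Set
G ≈ G′ = ∀ u v → adj G u v ≡ adj G′ u v

fromRel-cong : ∀ {n} {R S : Fin n → Fin n → Bool} → (∀ u v → R u v ≡ S u v) → fromRel R ≈ fromRel S
fromRel-cong R≡S u v = cong (not (does (u ≟ v)) ∧_) (cong₂ _∨_ (R≡S u v) (R≡S v u))

fromRel-adj : ∀ {n} (G : Graph n) → fromRel (adj G) ≈ G
fromRel-adj G u v with u ≟ v
... | yes refl = sym (adj-irrefl G u)
... | no  _    = trans (cong (adj G u v ∨_) (adj-sym G v u)) (∨-idem (adj G u v))

anyFun? : ∀ {m n} {P : (Fin m → Fin n) → Set} → Decidable P →
          (∀ {f g} → f ≗ g → P f → P g) → Dec (∃ P)
anyFun? P? resp = map′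
  (λ (i , p) → finToFun i , p)
  (λ (f , p) → funToFin f , resp (sym ∘ finToFun-funToFin f) p)
  (any? (P? ∘ finToFun))

anyGraph? : ∀ {n} {P : Graph n → Set} → Decidable P →
            (∀ {G G′} → G ≈ G′ → P G → P G′) → Dec (∃ P)
anyGraph? {n} P? resp = map′
  (λ (s , p) → decode s , p)
  (λ (G , p) → encode G , resp (λ u v → sym (decode-encode G u v)) p)
  (anySubset? (P? ∘ decode))
  where
  decode : Subset (n * n) → Graph n
  decode s = fromRel (λ u v → lookup s (combine u v))

  encode : Graph n → Subset (n * n)
  encode G = tabulate (uncurry (adj G) ∘ remQuot n)

  decode-encode : ∀ G → decode (encode G) ≈ G
  decode-encode G u v = trans
    (fromRel-cong (λ x y → trans (lookup∘tabulate _ (combine x y))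
                                 (cong (uncurry (adj G)) (remQuot-combine x y))) u v)
    (fromRel-adj G u v)

contains? : ∀ {n m} (G : Graph n) (H : Graph m) → Dec (G Contains H)
contains? G H = anyFun?
  (λ f → map′ (λ inj {u} {v} → inj u v) (λ inj u v → inj)
           (all? λ u → all? λ v → (f u ≟ f v) →-dec (u ≟ v))
         ×-dec (all? λ u → all? λ v → T? (adj H u v) →-dec T? (adj G (f u) (f v))))
  (λ f≗g (inj , hom) →
    (λ {u} {v} gu≡gv → inj (trans (f≗g u) (trans gu≡gv (sym (f≗g v))))) ,
    (λ u v → subst₂ (λ x y → T (adj G x y)) (f≗g u) (f≗g v) ∘ hom u v))

colorable? : ∀ {n} k (G : Graph n) → Dec (Colorable k G)
colorable? k G = anyFun?
  (λ c → all? λ u → all? λ v → T? (adj G u v) →-dec ¬? (c u ≟ c v))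
  (λ f≗g ok u v uv gu≡gv → ok u v uv (trans (f≗g u) (trans gu≡gv (sym (f≗g v)))))

Contains-resp : ∀ {n m} {H : Graph m} {G G′ : Graph n} → G ≈ G′ → G Contains H → G′ Contains H
Contains-resp G≈G′ (f , inj , hom) =
  f , inj , λ u v → subst T (G≈G′ (f u) (f v)) ∘ hom u v

Colorable-resp : ∀ {n k} {G G′ : Graph n} → G ≈ G′ → Colorable k G → Colorable k G′
Colorable-resp G≈G′ (c , ok) = c , λ u v → ok u v ∘ subst T (sym (G≈G′ u v))

≈-sym : ∀ {n} {G G′ : Graph n} → G ≈ G′ → G′ ≈ G
≈-sym G≈G′ u v = sym (G≈G′ u v)

─-cong : ∀ {n} {G G′ F F′ : Graph n} → G ≈ G′ → F ≈ F′ → (G ─ F) ≈ (G′ ─ F′)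
─-cong G≈G′ F≈F′ u v = cong₂ (λ a b → a ∧ not b) (G≈G′ u v) (F≈F′ u v)

edgeCount-cong : ∀ {n} {G G′ : Graph n} → G ≈ G′ → edgeCount G ≡ edgeCount G′
edgeCount-cong G≈G′ = sum-cong-≗ λ u → sum-cong-≗ λ v →
  cong (λ b → if (toℕ u <ᵇ toℕ v) ∧ b then 1 else 0) (G≈G′ u v)

sum-≤ : ∀ {n} c (f : Fin n → ℕ) → (∀ i → f i ≤ c) → sum f ≤ n * c
sum-≤ {zero}  c f f≤c = z≤n
sum-≤ {suc n} c f f≤c = +-mono-≤ (f≤c zero) (sum-≤ c (f ∘ suc) (f≤c ∘ suc))

edgeCount-≤ : ∀ {n} (G : Graph n) → edgeCount G ≤ n * n
edgeCount-≤ {n} G = sum-≤ n _ λ u →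
  ≤-trans (sum-≤ 1 _ λ v → bit≤1 ((toℕ u <ᵇ toℕ v) ∧ adj G u v)) (≤-reflexive (*-identityʳ n))
  where
  bit≤1 : ∀ b → (if b then 1 else 0) ≤ 1
  bit≤1 true  = ≤-refl
  bit≤1 false = z≤n

deletableTo? : ∀ {n} (G : Graph n) k → Decidable (DeletableTo G k)
deletableTo? G k j = anyGraph?
  (λ F → (all? λ u → all? λ v → T? (adj F u v) →-dec T? (adj G u v))
         ×-dec (edgeCount F ≟ℕ j)
         ×-dec colorable? k (G ─ F))
  (λ {F} {F′} F≈F′ (F⊆G , eq , col) →
    (λ u v → F⊆G u v ∘ subst T (sym (F≈F′ u v))) ,
    trans (sym (edgeCount-cong {G = F} {F′} F≈F′)) eq ,
    Colorable-resp {G = G ─ F} {G ─ F′} (─-cong {G = G} {G} {F} {F′} (λ _ _ → refl) F≈F′) col)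

DeletableTo-resp : ∀ {n k j} {G G′ : Graph n} → G ≈ G′ → DeletableTo G k j → DeletableTo G′ k j
DeletableTo-resp {G = G} {G′} G≈G′ (F , F⊆G , eq , col) =
  F , (λ u v → subst T (G≈G′ u v) ∘ F⊆G u v) , eq ,
  Colorable-resp {G = G ─ F} {G′ ─ F} (─-cong {G = G} {G′} {F} {F} G≈G′ (λ _ _ → refl)) col

Is-h-resp : ∀ {n k j} {G G′ : Graph n} → G ≈ G′ → Is-h G k j → Is-h G′ k j
Is-h-resp {G = G} {G′} G≈G′ (d , lb) =
  DeletableTo-resp {G = G} {G′} G≈G′ d ,
  λ j d′ → lb j (DeletableTo-resp {G = G′} {G} (≈-sym {G = G} {G′} G≈G′) d′)

deleteAll : ∀ {n} (G : Graph n) k .{{_ : NonZero k}} → DeletableTo G k (edgeCount G)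
deleteAll G (suc k) =
  G , (λ _ _ e → e) , refl , (λ _ → zero) , λ u v e → contradiction e (noEdge (adj G u v))
  where
  noEdge : ∀ b → ¬ T (b ∧ not b)
  noEdge true  ()
  noEdge false ()

Is-h-exists : ∀ {n} (G : Graph n) k .{{_ : NonZero k}} → ∃ (Is-h G k)
Is-h-exists G k = minimum (deletableTo? G k) (_ , deleteAll G k)

is-h? : ∀ {n} (G : Graph n) k .{{_ : NonZero k}} → Decidable (Is-h G k)
is-h? G k j with Is-h-exists G k
... | m , m-min = map′ (λ { refl → m-min }) (IsMinimum-unique m-min) (m ≟ℕ j)

Is-hₙ-exists : ∀ {m} n k .{{_ : NonZero k}} (H : Graph m) (u v : Fin m) → T (adj H u v) →
               ∃ (Is-hₙ n k H)
Is-hₙ-exists n k H u v uv = maximum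
  (λ j → anyGraph? (λ G → ¬? (contains? G H) ×-dec is-h? G k j)
    (λ {G} {G′} G≈G′ (free , is-h) →
      (λ c → free (Contains-resp {H = H} {G′} {G} (≈-sym {G = G} {G′} G≈G′) c)) ,
      Is-h-resp {G = G} {G′} G≈G′ is-h))
  (proj₁ h-empty , empty , (λ (f , _ , hom) → hom u v uv) , proj₂ h-empty)
  (n * n)
  (λ j (G , _ , _ , lb) → ≤-trans (lb _ (deleteAll G k)) (edgeCount-≤ G))
  where
  empty : Graph n
  empty = record { adj = λ _ _ → false ; adj-sym = λ _ _ → refl ; adj-irrefl = λ _ → refl }

  h-empty : ∃ (Is-h empty k)
  h-empty = Is-h-exists empty k

wheel-hₙ-exists : ∀ n k .{{_ : NonZero k}} ℓ .{{_ : NonZero ℓ}} → ∃ (Is-hₙ n k (wheel ℓ))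
wheel-hₙ-exists n k (suc ℓ) = Is-hₙ-exists n k (wheel (suc ℓ)) zero (suc zero) _

{-# OPTIONS --safe #-}
module Submission where

-- Colour greedily with about k colours as soon as all degrees are below D ≈ n / q^r, where
-- q^(r+1) ≈ k; this costs at most D / k clashes per vertex. As long as a vertex v has D remaining
-- neighbours, colour D of them with O(q) fresh colours, again at a cost of D / q^(r+1) clashes per
-- vertex, and remove them; this happens at most n / D times, so it uses O(q^(r+1)) colours.
--
-- The neighbourhood of v contains no cycle of length 2r + 1. A tree of depth r inside it can be
-- properly coloured with boundedly many colours: sort the edges inside a level by the height at
-- which their ends meet in the tree and orient them by the children of the meeting point; a long
-- directed path closes up through the tree to a (2r+1)-cycle, so the length of a longest directed
-- path ending at a vertex is a bounded proper colouring. Hence in a set of α q^(r+1) vertices one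
-- can carve off balls with boundary at most q times as large, which are mutually non-adjacent and
-- share these colours, until all degrees in the rest are at most α q. If the rest is at least half
-- of the set it is coloured greedily with q colours, and otherwise the balls are a fraction 1/(2q)
-- of it; either way O(q / N) colours per coloured vertex are spent, N being the size of the set.
-- Repeating until the set has shrunk by a factor 2^(r+1), and then halving q, uses O(q) colours in all.

open import Defs
import Data.Nat.Properties as ℕ
open import Algebra.Properties.CommutativeMonoid.Sum ℕ.+-0-commutativeMonoid
  using (sum; sum-syntax; sum-cong-≗; ∑-distrib-+; ∑-comm; sum-replicate-zero)
open import Data.Bool using (Bool; true; false; T; not; _∧_; _∨_; if_then_else_)
open import Data.Bool.Properties using (T-∧; T-∨; T-≡)
open import Data.Empty using (⊥-elim)
open import Data.Fin using (Fin; zero; suc; toℕ; _≟_; combine; funToFin; finToFun; fromℕ<)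
open import Data.Fin.Properties
  using (any?; toℕ<n; toℕ-injective; toℕ-fromℕ<; combine-injective; finToFun-funToFin)
open import Data.List using (List; []; _∷_; _++_; length; lookup)
open import Data.List.Membership.Propositional.Properties using (∈-lookup)
open import Data.List.Properties using (length-++)
open import Data.List.Relation.Unary.All using (All; []; _∷_)
import Data.List.Relation.Unary.All as All
import Data.List.Relation.Unary.All.Properties as All
open import Data.List.Relation.Unary.AllPairs using ([]; _∷_)
import Data.List.Relation.Unary.AllPairs.Properties as AllPairs
open import Data.List.Relation.Unary.Unique.Propositional using (Unique)
open import Data.Nat using (ℕ; zero; suc; _+_; _*_; _^_; _∸_; _⊓_; _/_; _%_; _≤_; _<_; _≡ᵇ_; _<ᵇ_;
  z≤n; s≤s; _≤?_; _<?_; NonZero; >-nonZero; >-nonZero⁻¹) renaming (_≟_ to _≟ℕ_)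
open import Data.Nat.DivMod using (m/n*n≤m; m≡m%n+[m/n]*n; m%n<n)
open import Data.Nat.Properties hiding (_≟_; _≤?_; _<?_)
open import Data.Nat.Tactic.RingSolver using (solve-∀)
open import Data.Product using (∃; ∃₂; _×_; _,_; proj₁; proj₂)
open import Data.Sum using (_⊎_; inj₁; inj₂; [_,_]′)
open import Data.Unit using (⊤; tt)
open import Function using (_∘_; Equivalence)
open import Relation.Binary.Definitions using (tri<; tri≈; tri>)
open import Relation.Binary.PropositionalEquality
open import Relation.Nullary using (Dec; does; yes; no; ¬_; contradiction)
open import Relation.Nullary.Decidable using (_×-dec_; T?; dec-true)

-- Walks, cycles and wheels.

VSet : ℕ → Set
VSet n = Fin n → Bool

_∈_ : ∀ {n} → Fin n → VSet n → Set
v ∈ A = T (A v)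

infix 4 _∈_

∧⁻ : ∀ x {y} → T (x ∧ y) → T x × T y
∧⁻ x = Equivalence.to (T-∧ {x})

∧⁺ : ∀ {x y} → T x → T y → T (x ∧ y)
∧⁺ {x} {y} p q = Equivalence.from (T-∧ {x} {y}) (p , q)

Adj : ∀ {n} → Graph n → Fin n → Fin n → Set
Adj G u v = T (adj G u v)

Adj-sym : ∀ {n} (G : Graph n) {u v} → Adj G u v → Adj G v u
Adj-sym G {u} {v} = subst T (adj-sym G u v)

Adj⇒≢ : ∀ {n} (G : Graph n) {u v} → Adj G u v → u ≢ v
Adj⇒≢ G {u} uv refl = subst T (adj-irrefl G u) uv

-- The index lists all visited vertices, ends included, so a cycle is a walk with a `Unique` list
-- and a closing edge, and its length is that of the list.
data Walk {n} (G : Graph n) : Fin n → Fin n → List (Fin n) → Set where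
  [_] : ∀ a → Walk G a a (a ∷ [])
  _∷_ : ∀ {a b c xs} → Adj G a b → Walk G b c xs → Walk G a c (a ∷ xs)

module _ {n} {G : Graph n} where

  snoc : ∀ {a b c xs} → Walk G a b xs → Adj G b c → Walk G a c (xs ++ c ∷ [])
  snoc [ a ]    bc = bc ∷ [ _ ]
  snoc (e ∷ w) bc = e ∷ snoc w bc

  lookup-first : ∀ {a b xs} → Walk G a b xs → ∀ i → toℕ i ≡ 0 → lookup xs i ≡ a
  lookup-first [ a ]   zero _ = refl
  lookup-first (_ ∷ _) zero _ = refl

  lookup-last : ∀ {a b xs} → Walk G a b xs → ∀ i → suc (toℕ i) ≡ length xs → lookup xs i ≡ b
  lookup-last [ a ]              zero    _  = refl
  lookup-last (_ ∷ [ b ])       (suc i) eq = lookup-last [ b ] i (suc-injective eq)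
  lookup-last (_ ∷ w@(_ ∷ _))  (suc i) eq = lookup-last w i (suc-injective eq)

  lookup-step : ∀ {a b xs} → Walk G a b xs → ∀ i j → suc (toℕ i) ≡ toℕ j →
                Adj G (lookup xs i) (lookup xs j)
  lookup-step [ a ]   zero    zero ()
  lookup-step (e ∷ w) zero    (suc j) eq =
    subst (Adj G _) (sym (lookup-first w j (sym (suc-injective eq)))) e
  lookup-step (e ∷ w) (suc i) (suc j) eq = lookup-step w i j (suc-injective eq)

lookup-injective : ∀ {A : Set} {xs : List A} → Unique xs → ∀ i j → lookup xs i ≡ lookup xs j → i ≡ j
lookup-injective (_ ∷ _)  zero    zero    _  = refl
lookup-injective (x∉ ∷ _) zero    (suc j) eq = contradiction eq (All.lookup x∉ (∈-lookup j))
lookup-injective (x∉ ∷ _) (suc i) zero    eq = contradiction (sym eq) (All.lookup x∉ (∈-lookup i))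
lookup-injective (_ ∷ u)  (suc i) (suc j) eq = cong suc (lookup-injective u i j eq)

-- The hub differs from every rim vertex because adjacency is irreflexive. The wrap-around pair of
-- the rim is the closing edge.
cycle+hub⇒wheel : ∀ {n} (G : Graph n) {hub a b xs} → Walk G a b xs → Unique xs → Adj G b a →
                  All (Adj G hub) xs → G Contains wheel (length xs)
cycle+hub⇒wheel {n} G {hub} {a} {b} {xs} w uniq ba spokes = f , inj , hom
  where
  ℓ = length xs

  f : Fin (suc ℓ) → Fin n
  f zero    = hub
  f (suc i) = lookup xs i

  spoke : ∀ i → Adj G hub (lookup xs i)
  spoke i = All.lookup spokes (∈-lookup i)

  inj : ∀ {u v} → f u ≡ f v → u ≡ v
  inj {zero}  {zero}  _  = refl
  inj {zero}  {suc j} eq = contradiction eq (Adj⇒≢ G (spoke j))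
  inj {suc i} {zero}  eq = contradiction (sym eq) (Adj⇒≢ G (spoke i))
  inj {suc i} {suc j} eq = cong suc (lookup-injective uniq i j eq)

  rim : ∀ i j → T ((suc (toℕ i) ≡ᵇ toℕ j) ∨ ((suc (toℕ i) ≡ᵇ ℓ) ∧ (toℕ j ≡ᵇ 0))) →
        Adj G (lookup xs i) (lookup xs j)
  rim i j e with Equivalence.to (T-∨ {suc (toℕ i) ≡ᵇ toℕ j}) e
  ... | inj₁ next = lookup-step w i j (≡ᵇ⇒≡ _ _ next)
  ... | inj₂ wrap = let last , first = ∧⁻ (suc (toℕ i) ≡ᵇ ℓ) wrap in
    subst₂ (Adj G) (sym (lookup-last w i (≡ᵇ⇒≡ _ _ last)))
                   (sym (lookup-first w j (≡ᵇ⇒≡ _ _ first))) ba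

  hom : ∀ u v → Adj (wheel ℓ) u v → Adj G (f u) (f v)
  hom zero    zero    ()
  hom zero    (suc j) _ = spoke j
  hom (suc i) zero    _ = Adj-sym G (spoke i)
  hom (suc i) (suc j) e
    with Equivalence.to (T-∨ {(suc (toℕ i) ≡ᵇ toℕ j) ∨ ((suc (toℕ i) ≡ᵇ ℓ) ∧ (toℕ j ≡ᵇ 0))})
           (proj₂ (∧⁻ (not (does (suc i ≟ suc j))) e))
  ... | inj₁ ij = rim i j ij
  ... | inj₂ ji = Adj-sym G (rim j i ji)

-- Rooted trees of bounded depth and the cycles that close through them.

-- The functions are total but constrained only on `B`. As only the root can have level 0, climbing
-- from two vertices of equal level makes them meet. Levels need not be distances in `G`.
record Tree {n} (G : Graph n) (d : ℕ) (B : VSet n) : Set where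
  field
    root     : Fin n
    level    : Fin n → ℕ
    parent   : Fin n → Fin n
    level≤   : ∀ {x} → x ∈ B → level x ≤ d
    level-0  : ∀ {x} → x ∈ B → level x ≡ 0 → x ≡ root
    parent∈  : ∀ {x t} → x ∈ B → level x ≡ suc t → parent x ∈ B
    level-parent : ∀ {x t} → x ∈ B → level x ≡ suc t → level (parent x) ≡ t
    parent-adj   : ∀ {x t} → x ∈ B → level x ≡ suc t → Adj G x (parent x)

Proper : ∀ {n} → Graph n → VSet n → ℕ → Set
Proper {n} G A c = ∃ λ (f : Fin n → ℕ) →
  (∀ {v} → v ∈ A → f v < c) × (∀ {u v} → u ∈ A → v ∈ A → Adj G u v → f u ≢ f v)

module _ {P : ℕ → Set} (P? : ∀ s → Dec (P s)) where

  largest : ℕ → ℕ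
  largest zero    = zero
  largest (suc m) with P? (suc m)
  ... | yes _ = suc m
  ... | no  _ = largest m

  largest≤ : ∀ m → largest m ≤ m
  largest≤ zero    = z≤n
  largest≤ (suc m) with P? (suc m)
  ... | yes _ = ≤-refl
  ... | no  _ = m≤n⇒m≤1+n (largest≤ m)

  largest-holds : P 0 → ∀ m → P (largest m)
  largest-holds p0 zero    = p0
  largest-holds p0 (suc m) with P? (suc m)
  ... | yes p = p
  ... | no  _ = largest-holds p0 m

  ≤largest : ∀ m {s} → s ≤ m → P s → s ≤ largest m
  ≤largest zero    z≤n _ = z≤n
  ≤largest (suc m) {s} s≤ p with P? (suc m)
  ... | yes _ = s≤
  ... | no ¬p with m≤n⇒m<n∨m≡n s≤
  ...   | inj₁ (s≤s s≤m) = ≤largest m s≤m p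
  ...   | inj₂ refl      = contradiction p ¬p

module _ {n} {G : Graph n} {d} {B : VSet n} (tree : Tree G d B) where
  open Tree tree

  ancestor : ℕ → Fin n → Fin n
  ancestor zero    x = x
  ancestor (suc j) x = ancestor j (parent x)

  -- Both vertices climb together until their parents agree, at the root at the latest. The meeting
  -- point lies at height `j + 1`, one above the returned `j`.
  meeting-height : ∀ t {x y} → x ∈ B → y ∈ B → level x ≡ t → level y ≡ t → x ≢ y →
    ∃ λ j → j < t × ancestor j x ≢ ancestor j y × ancestor (suc j) x ≡ ancestor (suc j) y
  meeting-height zero x∈B y∈B lx ly x≢y =
    contradiction (trans (level-0 x∈B lx) (sym (level-0 y∈B ly))) x≢y
  meeting-height (suc t) {x} {y} x∈B y∈B lx ly x≢y with parent x ≟ parent y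
  ... | yes eq = 0 , s≤s z≤n , x≢y , eq
  ... | no  ne with meeting-height t (parent∈ x∈B lx) (parent∈ y∈B ly)
                     (level-parent x∈B lx) (level-parent y∈B ly) ne
  ...   | j , j<t , ≢j , ≡j = suc j , s≤s j<t , ≢j , ≡j

  AtOrBelow : ℕ → Fin n → Set
  AtOrBelow i z = z ∈ B × i ≤ level z

  -- Each round extends the path at both ends by parents. These are new, since the path so far has
  -- larger levels, and they differ until the meeting point, which both ends share and which closes
  -- the cycle. Everything stays in `B`, hence adjacent to the hub.
  close-up : ∀ {hub} → (∀ {x} → x ∈ B → Adj G hub x) →
    ∀ j i {a b xs} → Walk G a b xs → Unique xs → All (AtOrBelow (suc j + i)) xs →
    a ∈ B → b ∈ B → level a ≡ suc j + i → level b ≡ suc j + i →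
    ancestor j a ≢ ancestor j b → ancestor (suc j) a ≡ ancestor (suc j) b →
    G Contains wheel (length xs + (2 * j + 1))
  close-up spokes zero i {a} {b} {xs} w uniq below a∈B b∈B la lb _ meet =
    subst (λ ℓ → G Contains wheel ℓ) (+-comm 1 (length xs))
      (cycle+hub⇒wheel G (Adj-sym G (parent-adj a∈B la) ∷ w)
        (All.map (λ { (_ , l≤) refl → 1+n≰n (subst (suc i ≤_) (level-parent a∈B la) l≤) }) below ∷ uniq)
        (subst (Adj G b) (sym meet) (parent-adj b∈B lb))
        (spokes (parent∈ a∈B la) ∷ All.map (spokes ∘ proj₁) below))
  close-up spokes (suc j) i {a} {b} {xs} w uniq below a∈B b∈B la lb apart meet =
    subst (λ ℓ → G Contains wheel ℓ) len
      (close-up spokes j i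
        (Adj-sym G (parent-adj a∈B la) ∷ snoc w (parent-adj b∈B lb))
        (All.∷ʳ⁺ (fresh (level-parent a∈B la)) (apart ∘ cong (ancestor j))
          ∷ AllPairs.++⁺ uniq ([] ∷ []) (All.map (λ ≢b → (≢b ∘ sym) ∷ []) (fresh (level-parent b∈B lb))))
        ((parent∈ a∈B la , ≤-reflexive (sym (level-parent a∈B la)))
          ∷ All.∷ʳ⁺ (All.map (λ (z∈B , l≤) → z∈B , ≤-trans (n≤1+n _) l≤) below)
                    (parent∈ b∈B lb , ≤-reflexive (sym (level-parent b∈B lb))))
        (parent∈ a∈B la) (parent∈ b∈B lb) (level-parent a∈B la) (level-parent b∈B lb) apart meet)
    where
    fresh : ∀ {p} → level p ≡ suc j + i → All (p ≢_) xs
    fresh lp = All.map (λ { (_ , l≤) refl → 1+n≰n (subst (suc (suc j) + i ≤_) lp l≤) }) below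

    len : suc (length (xs ++ parent b ∷ [])) + (2 * j + 1) ≡ length xs + (2 * suc j + 1)
    len = trans (cong (λ l → suc l + (2 * j + 1)) (length-++ xs)) (arith (length xs) j)
      where
      arith : ∀ l j → suc (l + 1) + (2 * j + 1) ≡ l + (2 * suc j + 1)
      arith = solve-∀

  -- Orienting by the ancestors at height j makes the relation acyclic, and the ends of a directed
  -- path are joined through the tree by a path of length 2(j + 1) that misses the rest of it.
  _⟨_⟩⇒_ : Fin n → ℕ → Fin n → Set
  x ⟨ j ⟩⇒ y = x ∈ B × y ∈ B × Adj G x y × level x ≡ level y ×
    ancestor (suc j) x ≡ ancestor (suc j) y × toℕ (ancestor j x) < toℕ (ancestor j y)

  _⟨_⟩⇒?_ : ∀ x j y → Dec (x ⟨ j ⟩⇒ y)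
  x ⟨ j ⟩⇒? y = T? (B x) ×-dec T? (B y) ×-dec T? (adj G x y) ×-dec (level x ≟ℕ level y) ×-dec
    (ancestor (suc j) x ≟ ancestor (suc j) y) ×-dec (toℕ (ancestor j x) <? toℕ (ancestor j y))

  PathTo : ℕ → ℕ → Fin n → Set
  PathTo j zero    y = ⊤
  PathTo j (suc s) y = ∃ λ x → x ⟨ j ⟩⇒ y × PathTo j s x

  pathTo? : ∀ j s y → Dec (PathTo j s y)
  pathTo? j zero    y = yes tt
  pathTo? j (suc s) y = any? λ x → (x ⟨ j ⟩⇒? y) ×-dec pathTo? j s x

  module _ (j : ℕ) where

    -- The walk is kept backwards, from `y` to `start`, so that a further edge extends it at the
    -- head. By `inside`, a new end with a strictly larger ancestor at height `j` is not yet on the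
    -- path.
    record Monotone (s : ℕ) (y : Fin n) : Set where
      field
        {start} : Fin n
        {path}  : List (Fin n)
        walk    : Walk G y start path
        unique  : Unique path
        length≡ : length path ≡ suc s
        inside  : All (λ z → z ∈ B × level z ≡ level y × toℕ (ancestor j z) ≤ toℕ (ancestor j y)) path
        start∈  : start ∈ B
        level-start : level start ≡ level y
        below-start : toℕ (ancestor j start) ≤ toℕ (ancestor j y)
        meet-start  : ancestor (suc j) start ≡ ancestor (suc j) y

    monotone : ∀ s {y} → y ∈ B → PathTo j s y → Monotone s y
    monotone zero y∈B _ = record
      { walk = [ _ ] ; unique = [] ∷ [] ; length≡ = refl ; inside = (y∈B , refl , ≤-refl) ∷ []
      ; start∈ = y∈B ; level-start = refl ; below-start = ≤-refl ; meet-start = refl }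
    monotone (suc s) {y} y∈B (x , (x∈B , _ , xy , lx , meet , x<y) , p) = record
      { walk    = Adj-sym G xy ∷ walk
      ; unique  = All.map (λ { (_ , _ , z≤x) refl → <⇒≱ x<y z≤x }) inside ∷ unique
      ; length≡ = cong suc length≡
      ; inside  = (y∈B , refl , ≤-refl) ∷
                  All.map (λ (z∈B , lz , z≤x) → z∈B , trans lz lx , ≤-trans z≤x (<⇒≤ x<y)) inside
      ; start∈  = start∈
      ; level-start = trans level-start lx
      ; below-start = ≤-trans below-start (<⇒≤ x<y)
      ; meet-start  = trans meet-start meet
      }
      where open Monotone (monotone s x∈B p)

    -- At least one strict step separates the ancestors of the two ends at height `j`, while those
    -- at height `j + 1` agree, so `close-up` applies to the `s + 2` path vertices.
    long-path⇒wheel : ∀ {hub} → (∀ {x} → x ∈ B → Adj G hub x) →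
      ∀ s i {y} → level y ≡ suc j + i → y ∈ B → PathTo j (suc s) y →
      G Contains wheel (suc (suc s) + (2 * j + 1))
    long-path⇒wheel spokes s i {y} ly y∈B p@(x , (x∈B , _ , xy , lx , meet , x<y) , p′) =
      subst (λ l → G Contains wheel (l + (2 * j + 1))) length≡
        (close-up spokes j i walk unique
          (All.map (λ (z∈B , lz , _) → z∈B , ≤-reflexive (sym (trans lz ly))) inside)
          y∈B start∈ ly (trans level-start ly)
          (λ eq → <⇒≱ x<y (≤-trans (≤-reflexive (cong toℕ eq)) (Monotone.below-start (monotone s x∈B p′))))
          (sym meet-start))
      where open Monotone (monotone (suc s) y∈B p)

-- A bounded proper colouring of a tree inside a neighbourhood.

funToFin-injective : ∀ {m n} (f g : Fin m → Fin n) → funToFin f ≡ funToFin g → f ≗ g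
funToFin-injective f g eq i =
  trans (sym (finToFun-funToFin f i)) (trans (cong (λ k → finToFun k i) eq) (finToFun-funToFin g i))

-- The factors count the levels from 0 to `r` and, for each of `r` heights, the path lengths from 0
-- to `2 * r`.
palette : ℕ → ℕ
palette r = suc r * suc (2 * r) ^ r

-- The colour of x records its level and, for every j < r, the length of the longest monotone
-- path to x in the graph _⟨ j ⟩⇒_; that length stays below
-- 2(r - j) - 1, since such a path would close up to a cycle of length 2r + 1.
tree-colouring : ∀ {n} {G : Graph n} {r hub B} → wheel (2 * r + 1) Free G →
                 (∀ {x} → x ∈ B → Adj G hub x) → Tree G r B → Proper G B (palette r)
tree-colouring {n} {G} {r} {hub} {B} free spokes tree = toℕ ∘ col , (λ _ → toℕ<n _) , proper
  where
  open Tree tree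

  len : ℕ → Fin n → ℕ
  len j x = largest (λ s → pathTo? tree j s x) (2 * (r ∸ suc j))

  len< : ∀ j x → len j x < suc (2 * r)
  len< j x = s≤s (≤-trans (largest≤ (λ s → pathTo? tree j s x) _) (*-monoʳ-≤ 2 (m∸n≤m r (suc j))))

  level⊓r : Fin n → Fin (suc r)
  level⊓r x = fromℕ< (s≤s (m⊓n≤n (level x) r))

  lens : Fin n → Fin r → Fin (suc (2 * r))
  lens x j = fromℕ< (len< (toℕ j) x)

  col : Fin n → Fin (palette r)
  col x = combine (level⊓r x) (funToFin (lens x))

  col-level : ∀ {x y} → x ∈ B → y ∈ B → col x ≡ col y → level x ≡ level y
  col-level {x} {y} x∈B y∈B eq = begin
    level x                  ≡⟨ m≤n⇒m⊓n≡m (level≤ x∈B) ⟨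
    level x ⊓ r              ≡⟨ toℕ-fromℕ< _ ⟨
    toℕ (level⊓r x)          ≡⟨ cong toℕ (proj₁ (combine-injective (level⊓r x) (funToFin (lens x)) (level⊓r y) (funToFin (lens y)) eq)) ⟩
    toℕ (level⊓r y)          ≡⟨ toℕ-fromℕ< _ ⟩
    level y ⊓ r              ≡⟨ m≤n⇒m⊓n≡m (level≤ y∈B) ⟩
    level y                  ∎
    where open ≡-Reasoning

  col-len : ∀ {x y} → col x ≡ col y → ∀ {j} → j < r → len j x ≡ len j y
  col-len {x} {y} eq {j} j<r = begin
    len j x              ≡⟨ cong (λ t → len t x) (toℕ-fromℕ< j<r) ⟨
    len (toℕ ĵ) x        ≡⟨ toℕ-fromℕ< _ ⟨
    toℕ (lens x ĵ)       ≡⟨ cong toℕ (funToFin-injective (lens x) (lens y)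
                              (proj₂ (combine-injective (level⊓r x) (funToFin (lens x)) (level⊓r y) (funToFin (lens y)) eq)) ĵ) ⟩
    toℕ (lens y ĵ)       ≡⟨ toℕ-fromℕ< _ ⟩
    len (toℕ ĵ) y        ≡⟨ cong (λ t → len t y) (toℕ-fromℕ< j<r) ⟩
    len j y              ∎
    where
    open ≡-Reasoning
    ĵ = fromℕ< j<r

  cycle-length : ∀ {j} → j < r → suc (suc (2 * (r ∸ suc j))) + (2 * j + 1) ≡ 2 * r + 1
  cycle-length {j} j<r = trans (arith (r ∸ suc j) j) (cong (λ t → 2 * t + 1) (m∸n+n≡m j<r))
    where
    arith : ∀ e j → suc (suc (2 * e)) + (2 * j + 1) ≡ 2 * (e + suc j) + 1
    arith = solve-∀

  len-increases : ∀ {x y j t} → level y ≡ t → j < t → j < r → _⟨_⟩⇒_ tree x j y → len j x < len j y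
  len-increases {x} {y} {j} {t} ly j<t j<r x⇒y@(_ , y∈B , _) =
    ≤largest (λ s → pathTo? tree j s y) _ short path
    where
    path : PathTo tree j (suc (len j x)) y
    path = x , x⇒y , largest-holds (λ s → pathTo? tree j s x) tt (2 * (r ∸ suc j))

    short : len j x < 2 * (r ∸ suc j)
    -- At the cap, the path to `x` followed by `y` has `2 * (r ∸ suc j) + 2` vertices and closes up
    -- to a cycle of length exactly `2 * r + 1`.
    short with m≤n⇒m<n∨m≡n (largest≤ (λ s → pathTo? tree j s x) (2 * (r ∸ suc j)))
    ... | inj₁ lt = lt
    ... | inj₂ eq = contradiction
      (subst (λ ℓ → G Contains wheel ℓ) (trans (cong (λ l → suc (suc l) + (2 * j + 1)) eq) (cycle-length j<r))
        (long-path⇒wheel tree j spokes (len j x) (t ∸ suc j)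
          (trans ly (sym (m+[n∸m]≡n j<t))) y∈B path))
      free

  proper : ∀ {x y} → x ∈ B → y ∈ B → Adj G x y → toℕ (col x) ≢ toℕ (col y)
  proper {x} {y} x∈B y∈B xy same = separated (meeting-height tree (level y) x∈B y∈B lx refl (Adj⇒≢ G xy))
    where
    eq = toℕ-injective same
    lx = col-level x∈B y∈B eq

    separated : ¬ (∃ λ j → j < level y × ancestor tree j x ≢ ancestor tree j y ×
                       ancestor tree (suc j) x ≡ ancestor tree (suc j) y)
    separated (j , j<l , apart , meet) with <-cmp (toℕ (ancestor tree j x)) (toℕ (ancestor tree j y))
    ... | tri< x<y _ _ = <⇒≢ (len-increases refl j<l (<-≤-trans j<l (level≤ y∈B))
                                (x∈B , y∈B , xy , lx , meet , x<y))
                             (col-len eq (<-≤-trans j<l (level≤ y∈B)))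
    ... | tri≈ _ same′ _ = apart (toℕ-injective same′)
    ... | tri> _ _ y<x = <⇒≢ (len-increases lx j<l (<-≤-trans j<l (level≤ y∈B))
                                (y∈B , x∈B , Adj-sym G xy , sym lx , sym meet , y<x))
                             (sym (col-len eq (<-≤-trans j<l (level≤ y∈B))))

-- Counting vertices and pairs.

ι : Bool → ℕ
ι b = if b then 1 else 0

ι≤1 : ∀ b → ι b ≤ 1
ι≤1 true  = ≤-refl
ι≤1 false = z≤n

ι-mono : ∀ b c → (T b → T c) → ι b ≤ ι c
ι-mono false c     _ = z≤n
ι-mono true  true  _ = ≤-refl
ι-mono true  false h = ⊥-elim (h tt)

∑-mono : ∀ {n} {f g : Fin n → ℕ} → (∀ i → f i ≤ g i) → sum f ≤ sum g
∑-mono {zero}  _   = z≤n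
∑-mono {suc n} f≤g = +-mono-≤ (f≤g zero) (∑-mono (f≤g ∘ suc))

∑-*-distribˡ : ∀ {n} c (f : Fin n → ℕ) → c * sum f ≡ sum (λ i → c * f i)
∑-*-distribˡ {zero}  c f = *-zeroʳ c
∑-*-distribˡ {suc n} c f =
  trans (*-distribˡ-+ c (f zero) _) (cong (c * f zero +_) (∑-*-distribˡ c (f ∘ suc)))

size : ∀ {n} → VSet n → ℕ
size A = sum (ι ∘ A)

_⊑_ : ∀ {n} → VSet n → VSet n → Set
A ⊑ B = ∀ {v} → v ∈ A → v ∈ B

infix 4 _⊑_

_∪_ _∖_ : ∀ {n} → VSet n → VSet n → VSet n
(A ∪ B) v = A v ∨ B v
(A ∖ B) v = A v ∧ not (B v)

size-mono : ∀ {n} (A B : VSet n) → A ⊑ B → size A ≤ size B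
size-mono A B A⊑B = ∑-mono λ v → ι-mono (A v) (B v) A⊑B

size≤n : ∀ {n} (A : VSet n) → size A ≤ n
size≤n {n} A = subst (size A ≤_) (*-identityʳ n) (sum-≤ 1 (ι ∘ A) (ι≤1 ∘ A))

size-∖ : ∀ {n} (A B : VSet n) → B ⊑ A → size B + size (A ∖ B) ≡ size A
size-∖ A B B⊑A = trans (sym (∑-distrib-+ (ι ∘ B) (ι ∘ (A ∖ B)))) (sum-cong-≗ split)
  where
  split : ∀ v → ι (B v) + ι ((A ∖ B) v) ≡ ι (A v)
  split v with B v in eqB | A v in eqA
  ... | true  | true  = refl
  ... | false | true  = refl
  ... | false | false = refl
  ... | true  | false = ⊥-elim (subst T eqA (B⊑A (subst T (sym eqB) tt)))

∈⇒0<size : ∀ {n} {A : VSet n} {v} → v ∈ A → 0 < size A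
∈⇒0<size {suc n} {A} {zero}  v∈A with true ← A zero = s≤s z≤n
∈⇒0<size {suc n} {A} {suc v} v∈A = ≤-trans (∈⇒0<size {A = A ∘ suc} v∈A) (m≤n+m _ _)

size-∖-< : ∀ {n m} (A B : VSet n) → B ⊑ A → 0 < size B → size A < suc m → size (A ∖ B) < m
size-∖-< A B B⊑A 0<B (s≤s A≤m) = ≤-trans
  (+-monoˡ-≤ (size (A ∖ B)) 0<B) (≤-trans (≤-reflexive (size-∖ A B B⊑A)) A≤m)

subset-of-size : ∀ {n} (A : VSet n) d → d ≤ size A → ∃ λ (B : VSet n) → B ⊑ A × size B ≡ d
subset-of-size {zero}  A zero    _ = A , (λ p → p) , refl
subset-of-size {suc n} A d d≤ with A zero in eq
subset-of-size {suc n} A zero    d≤ | _     = (λ _ → false) , (λ ()) , sum-replicate-zero (suc n)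
subset-of-size {suc n} A (suc d) (s≤s d≤) | true  with subset-of-size (A ∘ suc) d d≤
... | B , B⊑A , B≡d = (λ { zero → true ; (suc v) → B v }) ,
  (λ { {zero} _ → subst T (sym eq) tt ; {suc v} → B⊑A }) , cong suc B≡d
subset-of-size {suc n} A (suc d) d≤ | false with subset-of-size (A ∘ suc) (suc d) d≤
... | B , B⊑A , B≡d = (λ { zero → false ; (suc v) → B v }) , (λ { {suc v} → B⊑A }) , B≡d

-- Each unordered pair is counted once, in the same order as in `edgeCount`, so that a clash count
-- on all vertices is definitionally an edge count.
pairs : ∀ {n} → (Fin n → Fin n → Bool) → ℕ
pairs {n} R = ∑[ u < n ] ∑[ v < n ] ι ((toℕ u <ᵇ toℕ v) ∧ R u v)

-- Colourings with few clashes.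

∃-≤-average : ∀ q (h : Fin (suc q) → ℕ) → ∃ λ c → suc q * h c ≤ sum h
∃-≤-average zero    h = zero , ≤-refl
∃-≤-average (suc q) h with ∃-≤-average q (h ∘ suc)
... | c , avg with ≤-total (h zero) (h (suc c))
...   | inj₁ 0≤c = zero , +-monoʳ-≤ (h zero) (≤-trans (*-monoʳ-≤ (suc q) 0≤c) avg)
...   | inj₂ c≤0 = suc c , +-mono-≤ c≤0 avg

colour-classes : ∀ q (b : Bool) (i : Fin q) → ∑[ c < q ] ι (b ∧ (toℕ c ≡ᵇ toℕ i)) ≡ ι b
colour-classes q false i = sum-replicate-zero q
colour-classes (suc q) true zero    = cong suc (sum-replicate-zero q)
colour-classes (suc q) true (suc i) = colour-classes q true i

-- Vertices are added one at a time, each with a colour causing at most the average number of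
-- clashes with those already coloured. A pair clashes for exactly one colour of the new vertex, so
-- this average is a share 1/(q + 1) of its pairs.
balanced-colouring : ∀ q {n} (R : Fin n → Fin n → Bool) → ∃ λ (f : Fin n → Fin (suc q)) →
  suc q * pairs (λ u v → R u v ∧ (toℕ (f u) ≡ᵇ toℕ (f v))) ≤ pairs R
balanced-colouring q {zero}  R = (λ ()) , ≤-reflexive (*-zeroʳ q)
balanced-colouring q {suc n} R
  with balanced-colouring q (λ u v → R (suc u) (suc v))
... | f , f-balanced
  with ∃-≤-average q (λ c → ∑[ v < n ] ι (R zero (suc v) ∧ (toℕ c ≡ᵇ toℕ (f v))))
... | c , c-average = f′ , (begin
  suc q * (sum row′ + rest′)          ≡⟨ *-distribˡ-+ (suc q) (sum row′) rest′ ⟩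
  suc q * sum row′ + suc q * rest′    ≤⟨ +-mono-≤ c-average f-balanced ⟩
  _ + pairs R′                        ≡⟨ cong (_+ pairs R′) (∑-comm {suc q} {n} (λ c v → ι (R zero (suc v) ∧ (toℕ c ≡ᵇ toℕ (f v))))) ⟩
  _ + pairs R′                        ≡⟨ cong (_+ pairs R′) (sum-cong-≗ λ v → colour-classes (suc q) (R zero (suc v)) (f v)) ⟩
  pairs R                             ∎)
  where
  open ≤-Reasoning
  R′ = λ u v → R (suc u) (suc v)
  f′ : Fin (suc n) → Fin (suc q)
  f′ zero    = c
  f′ (suc v) = f v
  row′ = λ v → ι (R zero (suc v) ∧ (toℕ c ≡ᵇ toℕ (f v)))
  rest′ = pairs (λ u v → R′ u v ∧ (toℕ (f u) ≡ᵇ toℕ (f v)))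

deg : ∀ {n} → Graph n → VSet n → Fin n → ℕ
deg G A v = size (λ u → A u ∧ adj G v u)

within : ∀ {n} → Graph n → VSet n → Fin n → Fin n → Bool
within G A u v = A u ∧ (A v ∧ adj G u v)

clashes : ∀ {n} → Graph n → VSet n → (Fin n → ℕ) → ℕ
clashes G A f = pairs (λ u v → within G A u v ∧ (f u ≡ᵇ f v))

record Colouring {n} (G : Graph n) (A : VSet n) (c w : ℕ) : Set where
  field
    colour   : Fin n → ℕ
    bounded  : ∀ {v} → v ∈ A → colour v < c
    clashes≤ : clashes G A colour ≤ w

≡ᵇ-+ : ∀ c x y → (c + x ≡ᵇ c + y) ≡ (x ≡ᵇ y)
≡ᵇ-+ zero    x y = refl
≡ᵇ-+ (suc c) x y = ≡ᵇ-+ c x y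

pairs-mono : ∀ {n} {R S : Fin n → Fin n → Bool} → (∀ u v → T (R u v) → T (S u v)) → pairs R ≤ pairs S
pairs-mono {R = R} {S} R⇒S = ∑-mono λ u → ∑-mono λ v → lemma (toℕ u <ᵇ toℕ v) u v
  where
  lemma : ∀ b u v → ι (b ∧ R u v) ≤ ι (b ∧ S u v)
  lemma false u v = z≤n
  lemma true  u v = ι-mono (R u v) (S u v) (R⇒S u v)

proper⇒colouring : ∀ {n} {G : Graph n} {A c} → Proper G A c → Colouring G A c 0
proper⇒colouring {n} {G} {A} (f , f< , ok) = record
  { colour = f ; bounded = f<
  ; clashes≤ = ≤-trans (pairs-mono noClash) (≤-reflexive zeros) }
  where
  noClash : ∀ u v → T (within G A u v ∧ (f u ≡ᵇ f v)) → T false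
  noClash u v t with ∧⁻ (within G A u v) t
  ... | uv , same with ∧⁻ (A u) uv
  ...   | u∈A , rest with ∧⁻ (A v) rest
  ...     | v∈A , e = ok u∈A v∈A e (≡ᵇ⇒≡ _ _ same)

  zeros : pairs {n} (λ _ _ → false) ≡ 0
  zeros = trans (sum-cong-≗ {n} λ u → trans (sum-cong-≗ {n} λ v → lemma (toℕ u <ᵇ toℕ v)) (sum-replicate-zero n))
                (sum-replicate-zero n)
    where
    lemma : ∀ b → ι (b ∧ false) ≡ 0
    lemma false = refl
    lemma true  = refl

colouring-⊑ : ∀ {n} {G : Graph n} {A B c w} → A ⊑ B → Colouring G B c w → Colouring G A c w
colouring-⊑ {G = G} {A} {B} A⊑B C = record
  { colour = colour ; bounded = λ v∈A → bounded (A⊑B v∈A)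
  ; clashes≤ = ≤-trans (pairs-mono restrict) clashes≤ }
  where
  open Colouring C
  restrict : ∀ u v → T (within G A u v ∧ (colour u ≡ᵇ colour v)) →
             T (within G B u v ∧ (colour u ≡ᵇ colour v))
  restrict u v t with ∧⁻ (within G A u v) t
  ... | uv , same with ∧⁻ (A u) uv
  ...   | u∈A , rest with ∧⁻ (A v) rest
  ...     | v∈A , e = ∧⁺ (∧⁺ (A⊑B u∈A) (∧⁺ {B v} (A⊑B v∈A) e)) same

pairs-∪ : ∀ {n} {R S Q : Fin n → Fin n → Bool} →
          (∀ u v → ι (R u v) ≤ ι (S u v) + ι (Q u v)) → pairs R ≤ pairs S + pairs Q
pairs-∪ {n} {R} {S} {Q} h = begin
  pairs R ≤⟨ ∑-mono (λ u → ∑-mono λ v → lemma (toℕ u <ᵇ toℕ v) u v) ⟩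
  _       ≡⟨ sum-cong-≗ (λ u → ∑-distrib-+ (λ v → ι ((toℕ u <ᵇ toℕ v) ∧ S u v)) _) ⟩
  _       ≡⟨ ∑-distrib-+ (λ u → ∑[ v < n ] ι ((toℕ u <ᵇ toℕ v) ∧ S u v)) _ ⟩
  pairs S + pairs Q ∎
  where
  open ≤-Reasoning
  lemma : ∀ b u v → ι (b ∧ R u v) ≤ ι (b ∧ S u v) + ι (b ∧ Q u v)
  lemma false u v = z≤n
  lemma true  u v = h u v

-- The second palette is shifted by `c`, so no pair between `A` and the rest clashes. Vertices in
-- both sets keep their colour from `A`.
colouring-∪ : ∀ {n} {G : Graph n} {A B S c c′ w w′} → S ⊑ A ∪ B →
              Colouring G A c w → Colouring G B c′ w′ → Colouring G S (c + c′) (w + w′)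
colouring-∪ {n} {G} {A} {B} {S} {c} {c′} S⊑ C C′ = colouring-⊑ S⊑ record
  { colour = h ; bounded = bound
  ; clashes≤ = ≤-trans (pairs-∪ split) (+-mono-≤ (clashes≤ C) (clashes≤ C′)) }
  where
  open Colouring
  f = colour C
  g = colour C′

  h : Fin n → ℕ
  h v = if A v then f v else c + g v

  bound : ∀ {v} → v ∈ A ∪ B → h v < c + c′
  bound {v} v∈ with A v in eq
  ... | true  = ≤-trans (bounded C (subst T (sym eq) tt)) (m≤m+n c c′)
  ... | false = +-monoʳ-< c (bounded C′ v∈)

  split : ∀ u v → ι (within G (A ∪ B) u v ∧ (h u ≡ᵇ h v)) ≤
          ι (within G A u v ∧ (f u ≡ᵇ f v)) + ι (within G B u v ∧ (g u ≡ᵇ g v))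
  split u v with A u in u∈ | A v in v∈
  ... | true  | true  = m≤m+n _ _
  ... | false | false rewrite ≡ᵇ-+ c (g u) (g v) = ≤-refl
  ... | true  | false = ≤-trans (ι-mono _ false λ t →
    <⇒≢ (≤-trans (bounded C (subst T (sym u∈) tt)) (m≤m+n c (g v)))
      (≡ᵇ⇒≡ _ _ (proj₂ (∧⁻ (B v ∧ adj G u v) t)))) z≤n
  ... | false | true  = ≤-trans (ι-mono _ false λ t →
    <⇒≢ (≤-trans (bounded C (subst T (sym v∈) tt)) (m≤m+n c (g u)))
      (sym (≡ᵇ⇒≡ _ _ (proj₂ (∧⁻ (B u ∧ adj G u v) t))))) z≤n

pairs-within≤ : ∀ {n} (G : Graph n) A → pairs (within G A) ≤ ∑[ v < n ] (ι (A v) * deg G A v)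
pairs-within≤ {n} G A = ∑-mono row
  where
  row : ∀ u → (∑[ v < n ] ι ((toℕ u <ᵇ toℕ v) ∧ within G A u v)) ≤ ι (A u) * deg G A u
  row u with A u
  ... | true  = ≤-trans
    (∑-mono {n} λ v → ι-mono ((toℕ u <ᵇ toℕ v) ∧ A v ∧ adj G u v) (A v ∧ adj G u v) (proj₂ ∘ ∧⁻ (toℕ u <ᵇ toℕ v)))
    (≤-reflexive (sym (+-identityʳ _)))
  ... | false = ≤-trans
    (∑-mono {n} λ v → ι-mono ((toℕ u <ᵇ toℕ v) ∧ false) false (proj₂ ∘ ∧⁻ (toℕ u <ᵇ toℕ v)))
    (≤-reflexive (sum-replicate-zero n))

-- The degree bound is the fraction d / b, multiplied out. The sum of the degrees bounds the edges
-- within `A`, and `balanced-colouring` leaves at most a share 1/q of these.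
greedy : ∀ {n} (G : Graph n) A q b d .{{_ : NonZero q}} → (∀ {v} → v ∈ A → deg G A v * b ≤ d) →
         ∃ λ w → Colouring G A q w × q * w * b ≤ d * size A
greedy {n} G A (suc q) b d low with balanced-colouring q (within G A)
... | f , balanced = clashes G A (toℕ ∘ f) ,
  record { colour = toℕ ∘ f ; bounded = λ {v} _ → toℕ<n (f v) ; clashes≤ = ≤-refl } ,
  (begin
    suc q * clashes G A (toℕ ∘ f) * b        ≤⟨ *-monoˡ-≤ b balanced ⟩
    pairs (within G A) * b                   ≤⟨ *-monoˡ-≤ b (pairs-within≤ G A) ⟩
    (∑[ v < n ] (ι (A v) * deg G A v)) * b     ≡⟨ *-comm _ b ⟩
    b * (∑[ v < n ] (ι (A v) * deg G A v))     ≡⟨ ∑-*-distribˡ b (λ v → ι (A v) * deg G A v) ⟩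
    (∑[ v < n ] (b * (ι (A v) * deg G A v)))   ≤⟨ ∑-mono row ⟩
    (∑[ v < n ] (d * ι (A v)))                 ≡⟨ ∑-*-distribˡ d (ι ∘ A) ⟨
    d * size A                               ∎)
  where
  open ≤-Reasoning
  row : ∀ v → b * (ι (A v) * deg G A v) ≤ d * ι (A v)
  row v with A v in eq
  ... | false = ≤-trans (≤-reflexive (*-zeroʳ b)) z≤n
  ... | true  = begin
    b * (1 * deg G A v)  ≡⟨ arith b (deg G A v) ⟩
    deg G A v * b        ≤⟨ low (subst T (sym eq) tt) ⟩
    d                    ≡⟨ *-identityʳ d ⟨
    d * 1                ∎
    where
    arith : ∀ b x → b * (1 * x) ≡ x * b
    arith = solve-∀

-- Growing balls and carving a set into them.

∨⁻ : ∀ x {y} → T (x ∨ y) → T x ⊎ T y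
∨⁻ x = Equivalence.to (T-∨ {x})

∨⁺ˡ : ∀ x {y} → T x → T (x ∨ y)
∨⁺ˡ x = Equivalence.from (T-∨ {x}) ∘ inj₁

∨⁺ʳ : ∀ x {y} → T y → T (x ∨ y)
∨⁺ʳ x = Equivalence.from (T-∨ {x}) ∘ inj₂

∈∖⁻ : ∀ {n} (A B : VSet n) {v} → v ∈ A ∖ B → v ∈ A × ¬ (v ∈ B)
∈∖⁻ A B {v} t with A v | B v
... | true | false = tt , λ ()

∈∖⁺ : ∀ {n} (A B : VSet n) {v} → v ∈ A → ¬ (v ∈ B) → v ∈ A ∖ B
∈∖⁺ A B {v} v∈A v∉B with A v | B v
... | true | true  = v∉B tt
... | true | false = tt

⊑∪∖ : ∀ {n} (A B : VSet n) → A ⊑ B ∪ (A ∖ B)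
⊑∪∖ A B {v} v∈A with A v | B v
... | true | true  = tt
... | true | false = tt

weaken : ∀ {n} {G : Graph n} {A c c′ w} → c ≤ c′ → Colouring G A c w → Colouring G A c′ w
weaken c≤ C = record { colour = colour ; bounded = λ v∈A → ≤-trans (bounded v∈A) c≤ ; clashes≤ = clashes≤ }
  where open Colouring C

module _ {n} (G : Graph n) where

  deeper : ∀ {d d′ B} → d ≤ d′ → Tree G d B → Tree G d′ B
  deeper d≤ tree = record
    { root = root ; level = level ; parent = parent ; level≤ = λ x∈B → ≤-trans (level≤ x∈B) d≤
    ; level-0 = level-0 ; parent∈ = parent∈ ; level-parent = level-parent ; parent-adj = parent-adj }
    where open Tree tree

  singleton : Fin n → VSet n
  singleton v x = does (x ≟ v)

  ∈singleton⁻ : ∀ {v x} → x ∈ singleton v → x ≡ v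
  ∈singleton⁻ {v} {x} t with yes x≡v ← x ≟ v = x≡v

  ∈singleton : ∀ v → v ∈ singleton v
  ∈singleton v = Equivalence.from T-≡ (dec-true (v ≟ v) refl)

  singleton-tree : ∀ v → Tree G 0 (singleton v)
  singleton-tree v = record
    { root = v ; level = λ _ → 0 ; parent = λ x → x ; level≤ = λ _ → z≤n
    ; level-0 = λ x∈ _ → ∈singleton⁻ x∈ ; parent∈ = λ _ () ; level-parent = λ _ () ; parent-adj = λ _ () }

  neighbour? : ∀ (B : VSet n) x → Dec (∃ λ y → T (B y ∧ adj G x y))
  neighbour? B x = any? λ y → T? (B y ∧ adj G x y)

  closure : VSet n → VSet n → VSet n
  closure S B x = B x ∨ (S x ∧ does (neighbour? B x))

  ⊑closure : ∀ S B → B ⊑ closure S B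
  ⊑closure S B {x} = ∨⁺ˡ (B x) {S x ∧ does (neighbour? B x)}

  closure⊑ : ∀ S B → B ⊑ S → closure S B ⊑ S
  closure⊑ S B B⊑S {x} x∈ with ∨⁻ (B x) x∈
  ... | inj₁ x∈B = B⊑S x∈B
  ... | inj₂ new = proj₁ (∧⁻ (S x) new)

  neighbour∈closure : ∀ S B {x y} → x ∈ S → y ∈ B → Adj G x y → x ∈ closure S B
  neighbour∈closure S B {x} {y} x∈S y∈B xy = ∨⁺ʳ (B x)
    (∧⁺ x∈S (Equivalence.from (T-≡ {does (neighbour? B x)})
      (dec-true (neighbour? B x) (y , ∧⁺ {B y} y∈B xy))))

  -- Each added vertex hangs below the neighbour in `B` that `neighbour?` finds, and old vertices
  -- keep their place, so the depth bound grows by one.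
  closure-tree : ∀ {d B} S → Tree G d B → Tree G (suc d) (closure S B)
  closure-tree {d} {B} S tree = record
    { root = root ; level = level′ ; parent = parent′
    ; level≤ = bound ; level-0 = at-root ; parent∈ = λ x∈ lx → ⊑closure S B (step∈ x∈ lx)
    ; level-parent = step-level ; parent-adj = step-adj }
    where
    open Tree tree

    level′ : Fin n → ℕ
    level′ x with T? (B x) | neighbour? B x
    ... | yes _ | _           = level x
    ... | no  _ | yes (y , _) = suc (level y)
    ... | no  _ | no _        = 0

    parent′ : Fin n → Fin n
    parent′ x with T? (B x) | neighbour? B x
    ... | yes _ | _           = parent x
    ... | no  _ | yes (y , _) = y
    ... | no  _ | no _        = x

    Old New : Fin n → Set
    Old x = x ∈ B × level′ x ≡ level x × parent′ x ≡ parent x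
    New x = ∃ λ y → y ∈ B × Adj G x y × level′ x ≡ suc (level y) × parent′ x ≡ y

    view : ∀ {x} → x ∈ closure S B → Old x ⊎ New x
    view {x} x∈ with T? (B x) | neighbour? B x
    ... | yes x∈B | _           = inj₁ (x∈B , refl , refl)
    ... | no  _   | yes (y , t) = inj₂ (y , proj₁ (∧⁻ (B y) t) , proj₂ (∧⁻ (B y) t) , refl , refl)
    ... | no  x∉B | no _        = ⊥-elim ([ x∉B , (λ new → proj₂ (∧⁻ (S x) new)) ]′ (∨⁻ (B x) x∈))

    level′-old : ∀ {x} → x ∈ B → level′ x ≡ level x
    level′-old {x} x∈B with T? (B x)
    ... | yes _   = refl
    ... | no  x∉B = contradiction x∈B x∉B

    bound : ∀ {x} → x ∈ closure S B → level′ x ≤ suc d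
    bound x∈ with view x∈
    ... | inj₁ (x∈B , l , _)         = ≤-trans (≤-reflexive l) (m≤n⇒m≤1+n (level≤ x∈B))
    ... | inj₂ (y , y∈B , _ , l , _) = ≤-trans (≤-reflexive l) (s≤s (level≤ y∈B))

    at-root : ∀ {x} → x ∈ closure S B → level′ x ≡ 0 → x ≡ root
    at-root x∈ l0 with view x∈
    ... | inj₁ (x∈B , l , _)       = level-0 x∈B (trans (sym l) l0)
    ... | inj₂ (_ , _ , _ , l , _) = contradiction (trans (sym l) l0) λ ()

    step∈ : ∀ {x t} → x ∈ closure S B → level′ x ≡ suc t → parent′ x ∈ B
    step∈ x∈ lx with view x∈
    ... | inj₁ (x∈B , l , p)         = subst (_∈ B) (sym p) (parent∈ x∈B (trans (sym l) lx))
    ... | inj₂ (y , y∈B , _ , _ , p) = subst (_∈ B) (sym p) y∈B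

    step-level : ∀ {x t} → x ∈ closure S B → level′ x ≡ suc t → level′ (parent′ x) ≡ t
    step-level x∈ lx with level′-old (step∈ x∈ lx) | view x∈
    ... | old | inj₁ (x∈B , l , p)       = trans old (trans (cong level p) (level-parent x∈B (trans (sym l) lx)))
    ... | old | inj₂ (y , _ , _ , l , p) = trans old (trans (cong level p) (suc-injective (trans (sym l) lx)))

    step-adj : ∀ {x t} → x ∈ closure S B → level′ x ≡ suc t → Adj G x (parent′ x)
    step-adj {x} x∈ lx with view x∈
    ... | inj₁ (x∈B , l , p)        = subst (Adj G x) (sym p) (parent-adj x∈B (trans (sym l) lx))
    ... | inj₂ (_ , _ , xy , _ , p) = subst (Adj G x) (sym p) xy

  proper-∪ : ∀ {A B c} → Proper G A c → Proper G B c →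
             (∀ {u v} → u ∈ A → v ∈ B → ¬ Adj G u v) → Proper G (A ∪ B) c
  proper-∪ {A} {B} {c} (f , f< , f-ok) (g , g< , g-ok) apart = h , bound , ok
    where
    h : Fin n → ℕ
    h v = if A v then f v else g v

    bound : ∀ {v} → v ∈ A ∪ B → h v < c
    bound {v} v∈ with A v in eq
    ... | true  = f< (subst T (sym eq) tt)
    ... | false = g< v∈

    ok : ∀ {u v} → u ∈ A ∪ B → v ∈ A ∪ B → Adj G u v → h u ≢ h v
    ok {u} {v} u∈ v∈ uv with A u in equ | A v in eqv
    ... | true  | true  = f-ok (subst T (sym equ) tt) (subst T (sym eqv) tt) uv
    ... | false | false = g-ok u∈ v∈ uv
    ... | true  | false = ⊥-elim (apart (subst T (sym equ) tt) v∈ uv)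
    ... | false | true  = ⊥-elim (apart (subst T (sym eqv) tt) u∈ (Adj-sym G uv))

  size-∪ : ∀ (A B : VSet n) → (∀ {v} → v ∈ B → ¬ (v ∈ A)) → size A + size B ≤ size (A ∪ B)
  size-∪ A B disjoint = ≤-trans
    (+-monoʳ-≤ (size A) (size-mono B ((A ∪ B) ∖ A) λ {v} v∈B →
      ∈∖⁺ (A ∪ B) A (∨⁺ʳ (A v) v∈B) (disjoint v∈B)))
    (≤-reflexive (size-∖ (A ∪ B) A λ {v} → ∨⁺ˡ (A v)))

  deg≤size-closure : ∀ S v → deg G S v ≤ size (closure S (singleton v))
  deg≤size-closure S v = size-mono (λ u → S u ∧ adj G v u) (closure S (singleton v)) λ {u} t →
    let u∈S , vu = ∧⁻ (S u) t in neighbour∈closure S (singleton v) u∈S (∈singleton v) (Adj-sym G vu)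

  -- The quotient a / b is the number of clashes allowed per vertex. In a set of at most (a/b) q^(r+1)
  -- vertices, a ball around a vertex of degree above (a/b) q cannot grow by a factor q in each of
  -- r steps after the first.
  module Carving (r K a b q : ℕ) .{{_ : NonZero b}} where

    slow-ball : ∀ S → size S * b ≤ a * q ^ suc r → ∀ e {d B} → d + e ≡ r → Tree G d B → B ⊑ S →
      a * q ^ d < size B * b →
      ∃ λ B′ → Tree G r B′ × B ⊑ B′ × B′ ⊑ S × size (closure S B′) ≤ q * size B′
    slow-ball S small e {d} {B} d+e tree B⊑S big with size (closure S B) ≤? q * size B
    ... | yes slow = B , deeper (subst (d ≤_) d+e (m≤m+n d e)) tree , (λ x → x) , B⊑S , slow
    ... | no  fast = next e d+e
      where
      C = closure S B

      bigger : a * q ^ suc d < size C * b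
      bigger = begin-strict
        a * (q * q ^ d)    ≡⟨ arith a q (q ^ d) ⟩
        q * (a * q ^ d)    ≤⟨ *-monoʳ-≤ q (<⇒≤ big) ⟩
        q * (size B * b)   ≡⟨ *-assoc q (size B) b ⟨
        q * size B * b     <⟨ *-monoˡ-< b (≰⇒> fast) ⟩
        size C * b         ∎
        where
        open ≤-Reasoning
        arith : ∀ a q x → a * (q * x) ≡ q * (a * x)
        arith = solve-∀

      next : ∀ e → d + e ≡ r →
        ∃ λ B′ → Tree G r B′ × B ⊑ B′ × B′ ⊑ S × size (closure S B′) ≤ q * size B′
      -- At depth `r` a fast step would put more than (a/b) q^(r+1) vertices into `S`.
      next zero d≡r = contradiction
        (≤-trans (*-monoˡ-≤ b (size-mono C S (closure⊑ S B B⊑S))) small)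
        (<⇒≱ (subst (λ t → a * q ^ suc t < size C * b) (trans (sym (+-identityʳ d)) d≡r) bigger))
      next (suc e) d+1+e with slow-ball S small e {suc d} {C} (trans (sym (+-suc d e)) d+1+e)
                                (closure-tree S tree) (closure⊑ S B B⊑S) bigger
      ... | B′ , tree′ , C⊑B′ , B′⊑S , slow =
        B′ , tree′ , (λ x∈B → C⊑B′ (⊑closure S B x∈B)) , B′⊑S , slow

    -- `near` collects the balls and `far` is the sparse remainder. As built by `carve`, the
    -- boundaries of the balls belong to neither and are paid for by the factor `q` in `covers`.
    record Carved (S : VSet n) : Set where
      field
        near far   : VSet n
        near⊑      : near ⊑ S
        far⊑       : far ⊑ S
        near-proper : Proper G near K
        far-sparse : ∀ {v} → v ∈ far → deg G far v * b ≤ a * q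
        covers     : size S ≤ q * size near + size far

    module _ {hub} (1≤r : 1 ≤ r)
      (colour-tree : ∀ {B} → (∀ {x} → x ∈ B → Adj G hub x) → Tree G r B → Proper G B K) where

      -- While some vertex has degree above (a/b) q, a slow ball near it joins `near` and its whole
      -- closure is removed. Later balls therefore have no edge to it and reuse its palette.
      carve : ∀ m S → size S < m → (∀ {x} → x ∈ S → Adj G hub x) → size S * b ≤ a * q ^ suc r → Carved S
      carve (suc m) S S<m spokes small
        with any? (λ v → T? (S v) ×-dec (a * q <? deg G S v * b))
      ... | no none = record
        { near = λ _ → false ; far = S ; near⊑ = λ () ; far⊑ = λ x → x
        ; near-proper = (λ _ → 0) , (λ ()) , (λ ())
        ; far-sparse = λ v∈S → ≮⇒≥ (λ high → none (_ , v∈S , high))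
        ; covers = m≤n+m (size S) _ }
      ... | yes (v , v∈S , high)
        -- The ball starts at depth 1, using one of the `r` levels; the high degree of `v` supplies
        -- the size required there.
        with slow-ball S small (r ∸ 1) {1} {closure S (singleton v)} (m+[n∸m]≡n 1≤r)
               (closure-tree S (singleton-tree v))
               (closure⊑ S (singleton v) (λ x∈ → subst (_∈ S) (sym (∈singleton⁻ x∈)) v∈S))
               (<-≤-trans (subst (λ t → a * t < deg G S v * b) (sym (*-identityʳ q)) high)
                          (*-monoˡ-≤ b (deg≤size-closure S v)))
      ... | B , tree , C₁⊑B , B⊑S , slow = record
        { near = B ∪ near ; far = far
        ; near⊑ = λ {x} x∈ → [ B⊑S , (λ x∈I → proj₁ (∈∖⁻ S C (near⊑ x∈I))) ]′ (∨⁻ (B x) x∈)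
        ; far⊑ = λ x∈L → proj₁ (∈∖⁻ S C (far⊑ x∈L))
        ; near-proper = proper-∪ {B} {near} (colour-tree (λ x∈B → spokes (B⊑S x∈B)) tree) near-proper
            λ {x} {y} x∈B y∈I xy → let y∈S , y∉C = ∈∖⁻ S C (near⊑ y∈I) in
              y∉C (neighbour∈closure S B y∈S x∈B (Adj-sym G xy))
        ; far-sparse = far-sparse
        ; covers = begin
            size S                                             ≡⟨ size-∖ S C C⊑S ⟨
            size C + size (S ∖ C)                              ≤⟨ +-mono-≤ slow covers ⟩
            q * size B + (q * size near + size far)            ≡⟨ arith q (size B) (size near) (size far) ⟩
            q * (size B + size near) + size far                ≤⟨ +-monoˡ-≤ (size far) (*-monoʳ-≤ q (size-∪ B near
              λ x∈I x∈B → proj₂ (∈∖⁻ S C (near⊑ x∈I)) (⊑closure S B x∈B))) ⟩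
            q * size (B ∪ near) + size far                     ∎
        }
        where
        open ≤-Reasoning
        C = closure S B

        C⊑S : C ⊑ S
        C⊑S = closure⊑ S B B⊑S

        v∈C : v ∈ C
        v∈C = ⊑closure S B (C₁⊑B (⊑closure S (singleton v) (∈singleton v)))

        arith : ∀ q x y z → q * x + (q * y + z) ≡ q * (x + y) + z
        arith = solve-∀

        open Carved (carve m (S ∖ C) (size-∖-< S C C⊑S (∈⇒0<size {A = C} v∈C) S<m)
          (λ x∈ → spokes (proj₁ (∈∖⁻ S C x∈)))
          (≤-trans (*-monoˡ-≤ b (≤-trans (m≤n+m _ (size C)) (≤-reflexive (size-∖ S C C⊑S)))) small))

-- Colouring a set inside one neighbourhood.

∖⊑ : ∀ {n} (A B : VSet n) → A ∖ B ⊑ A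
∖⊑ A B = proj₁ ∘ ∈∖⁻ A B

size-∖≤ : ∀ {n} (A B : VSet n) → size (A ∖ B) ≤ size A
size-∖≤ A B = size-mono (A ∖ B) A (∖⊑ A B)

deg≤size : ∀ {n} (G : Graph n) A v → deg G A v ≤ size A
deg≤size G A v = size-mono (λ u → A u ∧ adj G v u) A λ {u} → proj₁ ∘ ∧⁻ (A u)

^-distribʳ-* : ∀ o m n → (m * n) ^ o ≡ m ^ o * n ^ o
^-distribʳ-* zero    m n = refl
^-distribʳ-* (suc o) m n =
  trans (cong (m * n *_) (^-distribʳ-* o m n)) (interchange m n (m ^ o) (n ^ o))
  where
  interchange : ∀ a b c d → a * b * (c * d) ≡ a * c * (b * d)
  interchange = solve-∀

loss-∖ : ∀ {n} a b (S X : VSet n) {w w′} → X ⊑ S → w * b ≤ a * size X → w′ * b ≤ a * size (S ∖ X) →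
         (w + w′) * b ≤ a * size S
loss-∖ a b S X {w} {w′} X⊑S w≤ w′≤ = begin
  (w + w′) * b                        ≡⟨ *-distribʳ-+ b w w′ ⟩
  w * b + w′ * b                      ≤⟨ +-mono-≤ w≤ w′≤ ⟩
  a * size X + a * size (S ∖ X)       ≡⟨ *-distribˡ-+ a (size X) _ ⟨
  a * (size X + size (S ∖ X))         ≡⟨ cong (a *_) (size-∖ S X X⊑S) ⟩
  a * size S                          ∎
  where open ≤-Reasoning

-- The `4 * K * p * 2 ^ suc r` colours spent at one scale are exactly this factor times `p`, so that
-- doubling `p` doubles the total.
paletteFactor : ℕ → ℕ → ℕ
paletteFactor r K = 4 * K * 2 ^ suc r

module _ {n} (G : Graph n) (r K : ℕ) (1≤r : 1 ≤ r) (0<K : 0 < K)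
  (colour-tree : ∀ {hub B} → (∀ {x} → x ∈ B → Adj G hub x) → Tree G r B → Proper G B K) where

  K′ = paletteFactor r K

  module Neighbourhood {hub : Fin n} (a b : ℕ) .{{_ : NonZero a}} .{{_ : NonZero b}} where

    Spoked : VSet n → Set
    Spoked S = ∀ {x} → x ∈ S → Adj G hub x

    -- Colours are charged to the removed vertices at a rate of 2Kq / |S| each, so that the charges
    -- of successive steps can be summed; clashes are charged at the rate a / b.
    record Step (q : ℕ) (S : VSet n) : Set where
      field
        part      : VSet n
        colours loss : ℕ
        part⊑     : part ⊑ S
        part>0    : 0 < size part
        colouring : Colouring G part colours loss
        loss≤     : loss * b ≤ a * size part
        colours≤  : colours * size S ≤ 2 * K * q * size part

    step : ∀ q .{{_ : NonZero q}} S → Spoked S → 0 < size S → size S * b ≤ a * q ^ suc r → Step q S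
    step q S spokes 0<S small = choose (size S ≤? 2 * size far)
      where
      open Carving.Carved (Carving.carve G r K a b q 1≤r colour-tree (suc (size S)) S ≤-refl spokes small)
      open ≤-Reasoning

      positive : ∀ x → size S ≤ 2 * q * x → 0 < x
      positive zero    S≤ = contradiction (≤-trans S≤ (≤-reflexive (*-zeroʳ (2 * q)))) (<⇒≱ 0<S)
      positive (suc _) _  = s≤s z≤n

      choose : Dec (size S ≤ 2 * size far) → Step q S
      choose (yes S≤2far) with greedy G far q b (a * q) far-sparse
      ... | w , colouring , w≤ = record
        { part = far ; colours = q ; loss = w ; part⊑ = far⊑
        ; part>0 = positive (size far) (≤-trans S≤2far (*-monoˡ-≤ (size far) (m≤m*n 2 q)))
        ; colouring = colouring
        ; loss≤ = *-cancelˡ-≤ q (begin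
            q * (w * b)          ≡⟨ *-assoc q w b ⟨
            q * w * b            ≤⟨ w≤ ⟩
            a * q * size far     ≡⟨ arith₁ a q (size far) ⟩
            q * (a * size far)   ∎)
        ; colours≤ = begin
            q * size S               ≤⟨ *-monoʳ-≤ q S≤2far ⟩
            q * (2 * size far)       ≡⟨ arith₂ q (size far) ⟩
            1 * (2 * q * size far)   ≤⟨ *-monoˡ-≤ (2 * q * size far) 0<K ⟩
            K * (2 * q * size far)   ≡⟨ arith₃ K q (size far) ⟩
            2 * K * q * size far     ∎
        }
        where
        arith₁ : ∀ a q x → a * q * x ≡ q * (a * x)
        arith₁ = solve-∀
        arith₂ : ∀ q x → q * (2 * x) ≡ 1 * (2 * q * x)
        arith₂ = solve-∀
        arith₃ : ∀ K q x → K * (2 * q * x) ≡ 2 * K * q * x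
        arith₃ = solve-∀
      choose (no S≰2far) = record
        { part = near ; colours = K ; loss = 0 ; part⊑ = near⊑
        ; part>0 = positive (size near) S≤
        ; colouring = proper⇒colouring near-proper
        ; loss≤ = z≤n
        ; colours≤ = begin
            K * size S                ≤⟨ *-monoʳ-≤ K S≤ ⟩
            K * (2 * q * size near)   ≡⟨ arith₂ K q (size near) ⟩
            2 * K * q * size near     ∎
        }
        where
        arith₁ : ∀ q x y → 2 * (q * x + y) ≡ 2 * q * x + 2 * y
        arith₁ = solve-∀
        arith₂ : ∀ K q x → K * (2 * q * x) ≡ 2 * K * q * x
        arith₂ = solve-∀
        S≤ : size S ≤ 2 * q * size near
        S≤ = +-cancelʳ-≤ (size S) (size S) _ (begin
          size S + size S                      ≡⟨ cong (size S +_) (+-identityʳ (size S)) ⟨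
          2 * size S                           ≤⟨ *-monoʳ-≤ 2 covers ⟩
          2 * (q * size near + size far)       ≡⟨ arith₁ q (size near) (size far) ⟩
          2 * q * size near + 2 * size far     ≤⟨ +-monoʳ-≤ (2 * q * size near) (≰⇒≥ S≰2far) ⟩
          2 * q * size near + size S           ∎)

    Colourable : VSet n → ℕ → Set
    Colourable S c = ∃ λ w → Colouring G S c w × w * b ≤ a * size S

    module Phase (p : ℕ) .{{_ : NonZero p}}
      (smaller : ∀ S → Spoked S → size S * b ≤ a * p ^ suc r → Colourable S (K′ * p)) where

      M = a * p ^ suc r

      -- Each step spends colours in proportion to the vertices it removes, as |S| stays above M / b.
      peel : ∀ m S → size S < m → Spoked S → size S * b ≤ a * (2 * p) ^ suc r →
        ∃ λ c → Colourable S c × c * M ≤ 4 * K * p * (b * size S) + K′ * p * M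
      peel (suc m) S S<m spokes small with size S * b ≤? M
      ... | yes tiny = K′ * p , smaller S spokes tiny , m≤n+m _ _
      ... | no  big  = c + c′ ,
        (w + w′ , colouring-∪ (⊑∪∖ S part) colouring col′ , loss-∖ a b S part {w} {w′} part⊑ loss≤ w′≤) ,
        (begin
          (c + c′) * M              ≡⟨ *-distribʳ-+ M c c′ ⟩
          c * M + c′ * M            ≤⟨ +-mono-≤ c-bound c′≤ ⟩
          4 * K * p * (b * size part) + (4 * K * p * (b * size (S ∖ part)) + K′ * p * M)
            ≡⟨ arith₁ (4 * K * p) b (size part) (size (S ∖ part)) (K′ * p * M) ⟩
          4 * K * p * (b * (size part + size (S ∖ part))) + K′ * p * M
            ≡⟨ cong (λ s → 4 * K * p * (b * s) + K′ * p * M) (size-∖ S part part⊑) ⟩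
          4 * K * p * (b * size S) + K′ * p * M  ∎)
        where
        open ≤-Reasoning
        instance
          2p≢0 : NonZero (2 * p)
          2p≢0 = m*n≢0 2 p

        0<S : 0 < size S
        0<S = n≢0⇒n>0 λ S≡0 → big (subst (λ s → s * b ≤ M) (sym S≡0) z≤n)

        open Step (step (2 * p) S spokes 0<S small) renaming (colours to c; loss to w)

        rest = peel m (S ∖ part) (size-∖-< S part part⊑ part>0 S<m) (spokes ∘ ∖⊑ S part)
                 (≤-trans (*-monoˡ-≤ b (size-∖≤ S part)) small)
        c′ = proj₁ rest
        w′ = proj₁ (proj₁ (proj₂ rest))
        col′ = proj₁ (proj₂ (proj₁ (proj₂ rest)))
        w′≤ = proj₂ (proj₂ (proj₁ (proj₂ rest)))
        c′≤ = proj₂ (proj₂ rest)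

        arith₁ : ∀ k b x y z → k * (b * x) + (k * (b * y) + z) ≡ k * (b * (x + y)) + z
        arith₁ = solve-∀
        arith₂ : ∀ K p b x → 2 * K * (2 * p) * x * b ≡ 4 * K * p * (b * x)
        arith₂ = solve-∀

        c-bound : c * M ≤ 4 * K * p * (b * size part)
        c-bound = begin
          c * M                              ≤⟨ *-monoʳ-≤ c (≰⇒≥ big) ⟩
          c * (size S * b)                   ≡⟨ *-assoc c (size S) b ⟨
          c * size S * b                     ≤⟨ *-monoˡ-≤ b colours≤ ⟩
          2 * K * (2 * p) * size part * b    ≡⟨ arith₂ K p b (size part) ⟩
          4 * K * p * (b * size part)        ∎

      -- The hypothesis bounds `size S * b` by `2 ^ suc r * M`, so the steps of `peel` contribute at
      -- most `4 * K * p * 2 ^ suc r` colours, which is `K′ * p`. The final piece, coloured at scale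
      -- `p`, adds `K′ * p` again.
      double : ∀ S → Spoked S → size S * b ≤ a * (2 * p) ^ suc r → Colourable S (K′ * (2 * p))
      double S spokes small with peel (suc (size S)) S ≤-refl spokes small
      ... | c , (w , colouring , w≤) , c≤ = w , weaken c-bound colouring , w≤
        where
        open ≤-Reasoning
        instance
          M≢0 : NonZero M
          M≢0 = m*n≢0 a (p ^ suc r) {{it}} {{m^n≢0 p (suc r)}}
            where it : NonZero a
                  it = >-nonZero (>-nonZero⁻¹ a)

        arith : ∀ K p a t x → 4 * K * p * (a * (t * x)) + 4 * K * t * p * (a * x) ≡
                              4 * K * t * (2 * p) * (a * x)
        arith = solve-∀

        c-bound : c ≤ K′ * (2 * p)
        c-bound = *-cancelʳ-≤ c (K′ * (2 * p)) M (begin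
          c * M                                                           ≤⟨ c≤ ⟩
          4 * K * p * (b * size S) + K′ * p * M
            ≤⟨ +-monoˡ-≤ (K′ * p * M) (*-monoʳ-≤ (4 * K * p) (≤-trans (≤-reflexive (*-comm b _)) small)) ⟩
          4 * K * p * (a * (2 * p) ^ suc r) + K′ * p * M
            ≡⟨ cong (λ x → 4 * K * p * (a * x) + K′ * p * M) (^-distribʳ-* (suc r) 2 p) ⟩
          4 * K * p * (a * (2 ^ suc r * p ^ suc r)) + K′ * p * M
            ≡⟨ arith K p a (2 ^ suc r) (p ^ suc r) ⟩
          K′ * (2 * p) * M                                                ∎)

    -- Induction on the scale. At scale 1 the set has at most a / b vertices, so a single colour
    -- causes at most a / b clashes per vertex.
    colour-spoked : ∀ t S → Spoked S → size S * b ≤ a * (2 ^ t) ^ suc r → Colourable S (K′ * 2 ^ t)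
    colour-spoked zero S spokes small with greedy G S 1 b a
      (λ {v} _ → ≤-trans (*-monoˡ-≤ b (deg≤size G S v))
                   (≤-trans small (≤-reflexive (trans (cong (a *_) (^-zeroˡ (suc r))) (*-identityʳ a)))))
    ... | w , colouring , w≤ = w , weaken (*-mono-≤ 1≤K′ (≤-refl {1})) colouring ,
      subst (λ x → x * b ≤ a * size S) (+-identityʳ w) w≤
      where
      1≤K′ : 1 ≤ K′
      1≤K′ = *-mono-≤ (*-mono-≤ (s≤s (z≤n {3})) 0<K) (m^n>0 2 (suc r))
    colour-spoked (suc t) = Phase.double (2 ^ t) {{m^n≢0 2 t}} (colour-spoked t)

  -- Colouring the whole graph.

  module _ (t D : ℕ) (0<D : 0 < D) where

    private
      Q = 2 ^ t
      b = Q ^ suc r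
      instance
        Q≢0 : NonZero Q
        Q≢0 = m^n≢0 2 t
        b≢0 : NonZero b
        b≢0 = m^n≢0 Q (suc r)
        D≢0 : NonZero D
        D≢0 = >-nonZero 0<D

    -- Each neighbourhood piece has exactly `D` vertices, to which its `K′ * Q` colours are charged;
    -- this is the first term of the colour bound. The second pays for the one greedy colouring with
    -- `b` colours when all degrees are below `D`.
    cover : ∀ m S → size S < m → ∃₂ λ c w → Colouring G S c w × w * b ≤ D * size S ×
            c * D ≤ K′ * Q * size S + b * D
    cover (suc m) S S<m with any? (λ v → D ≤? deg G S v)
    ... | no none with greedy G S b 1 D
      (λ {v} _ → ≤-trans (≤-reflexive (*-identityʳ _)) (≰⇒≥ (λ D≤ → none (v , D≤))))
    ...   | w , colouring , w≤ = b , w , colouring ,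
      subst (_≤ D * size S) (trans (*-identityʳ (b * w)) (*-comm b w)) w≤ , m≤n+m _ _
    cover (suc m) S S<m | yes (v , D≤) with subset-of-size (λ u → S u ∧ adj G v u) D D≤
    ... | X , X⊑N , X≡D
      -- At the clash rate D / b, a set of size `D` meets the size condition with equality, as `b`
      -- is `Q ^ suc r`.
      with Neighbourhood.colour-spoked {v} D b t X (λ {u} u∈X → proj₂ (∧⁻ (S u) (X⊑N u∈X)))
             (≤-reflexive (cong (_* b) X≡D))
         | cover m (S ∖ X) (size-∖-< S X (λ {u} u∈X → proj₁ (∧⁻ (S u) (X⊑N u∈X))) (subst (0 <_) (sym X≡D) 0<D) S<m)
    ... | w , colouring , w≤ | c′ , w′ , colouring′ , w′≤ , c′≤ =
      K′ * Q + c′ , w + w′ , colouring-∪ (⊑∪∖ S X) colouring colouring′ ,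
      loss-∖ D b S X {w} {w′} X⊑S w≤ w′≤ ,
      (begin
        (K′ * Q + c′) * D                                         ≡⟨ *-distribʳ-+ D (K′ * Q) c′ ⟩
        K′ * Q * D + c′ * D                                       ≤⟨ +-monoʳ-≤ (K′ * Q * D) c′≤ ⟩
        K′ * Q * D + (K′ * Q * size (S ∖ X) + b * D)              ≡⟨ cong (λ d → K′ * Q * d + (K′ * Q * size (S ∖ X) + b * D)) X≡D ⟨
        K′ * Q * size X + (K′ * Q * size (S ∖ X) + b * D)         ≡⟨ arith (K′ * Q) (size X) (size (S ∖ X)) (b * D) ⟩
        K′ * Q * (size X + size (S ∖ X)) + b * D                  ≡⟨ cong (λ s → K′ * Q * s + b * D) (size-∖ S X X⊑S) ⟩
        K′ * Q * size S + b * D                                   ∎)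
      where
      open ≤-Reasoning
      X⊑S : X ⊑ S
      X⊑S {u} u∈X = proj₁ (∧⁻ (S u) (X⊑N u∈X))
      arith : ∀ k x y z → k * x + (k * y + z) ≡ k * (x + y) + z
      arith = solve-∀

  colour-all : ∀ t → (2 ^ t) ^ suc r ≤ n →
    ∃ λ w → Colouring G (λ _ → true) (suc K′ * (2 ^ t) ^ suc r) w × w * (2 ^ t) ^ (2 * r + 1) ≤ 2 * (n * n)
  colour-all t b≤n with cover t D (s≤s z≤n) (suc n) (λ _ → true) (s≤s (size≤n (λ _ → true)))
    where
    instance
      Qʳ≢0 : NonZero ((2 ^ t) ^ r)
      Qʳ≢0 = m^n≢0 (2 ^ t) r {{m^n≢0 2 t}}
    -- The successor makes `D` positive and gives `n ≤ D * (2 ^ t) ^ r`, which bounds the colours.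
    -- It at most doubles the clash bound, since `(2 ^ t) ^ r ≤ n`.
    D = suc (n / (2 ^ t) ^ r)
  ... | c , w , colouring , w≤ , c≤ = w , weaken c-bound colouring , w-bound
    where
    open ≤-Reasoning
    Q = 2 ^ t
    instance
      Q≢0 : NonZero Q
      Q≢0 = m^n≢0 2 t
      Qʳ≢0 : NonZero (Q ^ r)
      Qʳ≢0 = m^n≢0 Q r
    D = suc (n / Q ^ r)

    n≤DQʳ : n ≤ D * Q ^ r
    n≤DQʳ = begin
      n                                     ≡⟨ m≡m%n+[m/n]*n n (Q ^ r) ⟩
      n % Q ^ r + n / Q ^ r * Q ^ r         ≤⟨ +-monoˡ-≤ _ (<⇒≤ (m%n<n n (Q ^ r))) ⟩
      D * Q ^ r                             ∎

    DQʳ≤2n : D * Q ^ r ≤ 2 * n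
    DQʳ≤2n = +-mono-≤ (≤-trans (m≤n*m (Q ^ r) Q) b≤n)
                      (≤-trans (m/n*n≤m n (Q ^ r)) (≤-reflexive (sym (+-identityʳ n))))

    c-bound : c ≤ suc K′ * Q ^ suc r
    c-bound = *-cancelʳ-≤ c (suc K′ * Q ^ suc r) D (begin
      c * D                                     ≤⟨ c≤ ⟩
      K′ * Q * size {n} (λ _ → true) + Q ^ suc r * D
        ≤⟨ +-monoˡ-≤ (Q ^ suc r * D) (*-monoʳ-≤ (K′ * Q) (≤-trans (size≤n {n} (λ _ → true)) n≤DQʳ)) ⟩
      K′ * Q * (D * Q ^ r) + Q ^ suc r * D      ≡⟨ arith K′ Q D (Q ^ r) ⟩
      suc K′ * Q ^ suc r * D                    ∎)
      where
      arith : ∀ k q d x → k * q * (d * x) + q * x * d ≡ (1 + k) * (q * x) * d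
      arith = solve-∀

    w-bound : w * Q ^ (2 * r + 1) ≤ 2 * (n * n)
    w-bound = begin
      w * Q ^ (2 * r + 1)       ≡⟨ cong (λ e → w * Q ^ e) (exponent r) ⟩
      w * Q ^ (suc r + r)       ≡⟨ cong (w *_) (^-distribˡ-+-* Q (suc r) r) ⟩
      w * (Q ^ suc r * Q ^ r)   ≡⟨ *-assoc w (Q ^ suc r) (Q ^ r) ⟨
      w * Q ^ suc r * Q ^ r     ≤⟨ *-monoˡ-≤ (Q ^ r) w≤ ⟩
      D * size {n} (λ _ → true) * Q ^ r   ≤⟨ *-monoˡ-≤ (Q ^ r) (*-monoʳ-≤ D (size≤n {n} (λ _ → true))) ⟩
      D * n * Q ^ r             ≡⟨ arith D n (Q ^ r) ⟩
      D * Q ^ r * n             ≤⟨ *-monoˡ-≤ n DQʳ≤2n ⟩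
      2 * n * n                 ≡⟨ *-assoc 2 n n ⟩
      2 * (n * n)               ∎
      where
      exponent : ∀ r → 2 * r + 1 ≡ suc r + r
      exponent = solve-∀
      arith : ∀ d n x → d * n * x ≡ d * x * n
      arith = solve-∀

-- From colourings to the extremal number.

clashGraph : ∀ {n} → Graph n → (Fin n → ℕ) → Graph n
clashGraph G f = record
  { adj        = λ u v → adj G u v ∧ (f u ≡ᵇ f v)
  ; adj-sym    = λ u v → cong₂ _∧_ (adj-sym G u v) (≡ᵇ-sym (f u) (f v))
  ; adj-irrefl = λ v → cong (_∧ (f v ≡ᵇ f v)) (adj-irrefl G v)
  }
  where
  ≡ᵇ-sym : ∀ x y → (x ≡ᵇ y) ≡ (y ≡ᵇ x)
  ≡ᵇ-sym zero    zero    = refl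
  ≡ᵇ-sym zero    (suc y) = refl
  ≡ᵇ-sym (suc x) zero    = refl
  ≡ᵇ-sym (suc x) (suc y) = ≡ᵇ-sym x y

delete-clashes : ∀ {n} (G : Graph n) {k w} → Colouring G (λ _ → true) k w →
                 ∃ λ j → j ≤ w × DeletableTo G k j
delete-clashes {n} G {k} C = clashes G (λ _ → true) colour , clashes≤ ,
  clashGraph G colour , (λ u v → proj₁ ∘ ∧⁻ (adj G u v)) , refl , f , ok
  where
  open Colouring C

  f : Fin n → Fin k
  f v = fromℕ< (bounded {v} tt)

  separate : ∀ a x y → T (a ∧ not (a ∧ (x ≡ᵇ y))) → x ≢ y
  separate true x y t refl = subst (T ∘ not) (Equivalence.to T-≡ (≡⇒≡ᵇ x x refl)) t

  ok : ∀ u v → Adj (G ─ clashGraph G colour) u v → f u ≢ f v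
  ok u v t fu≡fv = separate (adj G u v) (colour u) (colour v) t
    (trans (sym (toℕ-fromℕ< (bounded {u} tt))) (trans (cong toℕ fu≡fv) (toℕ-fromℕ< (bounded {v} tt))))

n<2^n : ∀ n → n < 2 ^ n
n<2^n zero    = s≤s z≤n
n<2^n (suc n) = +-mono-≤ (m^n>0 2 n) (≤-trans (n<2^n n) (≤-reflexive (sym (+-identityʳ _))))

m≤m^1+n : ∀ m n → m ≤ m ^ suc n
m≤m^1+n zero    n = z≤n
m≤m^1+n (suc m) n = m≤m*n (suc m) (suc m ^ n) {{m^n≢0 (suc m) n}}

-- Eliminates the scale `x`: in the product on the left, the bound on `k` brings in `x` with
-- exponent (r + 1)(2r + 1), which is just what the bound on `h`, raised to the power `suc r`,
-- absorbs.
combine-bounds : ∀ r L n k h x → k ≤ L * 2 ^ suc r * x ^ suc r → h * x ^ (2 * r + 1) ≤ 2 * (n * n) →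
                 h ^ (r + 1) * k ^ (2 * r + 1) ≤ (2 * (L * 2 ^ suc r) ^ (2 * r + 1) * n ^ 2) ^ (r + 1)
combine-bounds r L n k h x k≤ h≤ = begin
  h ^ (r + 1) * k ^ e                    ≡⟨ cong (λ s → h ^ s * k ^ e) (+-comm r 1) ⟩
  h ^ suc r * k ^ e                      ≤⟨ *-monoʳ-≤ (h ^ suc r) (^-monoˡ-≤ e k≤) ⟩
  h ^ suc r * (N * x ^ suc r) ^ e        ≡⟨ cong (h ^ suc r *_) (^-distribʳ-* e N (x ^ suc r)) ⟩
  h ^ suc r * (C * (x ^ suc r) ^ e)      ≡⟨ cong (λ y → h ^ suc r * (C * y)) power-swap ⟩
  h ^ suc r * (C * (x ^ e) ^ suc r)      ≡⟨ arith₁ (h ^ suc r) C ((x ^ e) ^ suc r) ⟩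
  C * (h ^ suc r * (x ^ e) ^ suc r)      ≡⟨ cong (C *_) (^-distribʳ-* (suc r) h (x ^ e)) ⟨
  C * (h * x ^ e) ^ suc r                ≤⟨ *-mono-≤ (m≤m^1+n C r) (^-monoˡ-≤ (suc r) h≤) ⟩
  C ^ suc r * (2 * (n * n)) ^ suc r      ≡⟨ ^-distribʳ-* (suc r) C (2 * (n * n)) ⟨
  (C * (2 * (n * n))) ^ suc r            ≡⟨ cong₂ _^_ (arith₂ C n) (+-comm 1 r) ⟩
  (2 * C * n ^ 2) ^ (r + 1)              ∎
  where
  open ≤-Reasoning
  e = 2 * r + 1
  N = L * 2 ^ suc r
  C = N ^ e

  power-swap : (x ^ suc r) ^ e ≡ (x ^ e) ^ suc r
  power-swap = trans (^-*-assoc x (suc r) e)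
                (trans (cong (x ^_) (*-comm (suc r) e)) (sym (^-*-assoc x e (suc r))))
  arith₁ : ∀ a b c → a * (b * c) ≡ b * (a * c)
  arith₁ = solve-∀
  arith₂ : ∀ c n → c * (2 * (n * n)) ≡ 2 * c * (n * (n * 1))
  arith₂ = solve-∀

-- The largest `t` whose palette fits into `k` colours is used. The next palette is too large, so
-- `k` is less than `2 ^ suc r` times the chosen one, and `combine-bounds` turns the dyadic bound
-- into one in `k`.
dyadic-colourings⇒bound : ∀ {m} (H : Graph m) r L .{{_ : NonZero L}} →
  (∀ {n} (G : Graph n) → H Free G → ∀ t → (2 ^ t) ^ suc r ≤ n →
    ∃ λ w → Colouring G (λ _ → true) (L * (2 ^ t) ^ suc r) w × w * (2 ^ t) ^ (2 * r + 1) ≤ 2 * (n * n)) →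
  ∀ n k → 2 ≤ k → k ≤ n → ∀ h → Is-hₙ n k H h →
  h ^ (r + 1) * k ^ (2 * r + 1) ≤ (2 * (L * 2 ^ suc r) ^ (2 * r + 1) * n ^ 2) ^ (r + 1)
dyadic-colourings⇒bound H r L colouring n k 2≤k k≤n h ((G , free , _ , minimal) , _)
  with L * 1 ^ suc r ≤? k
-- Here `k < L`, and the trivial bound h ≤ n² suffices at scale 1.
... | no few = combine-bounds r L n k h 1
  (≤-trans (≰⇒≥ few) (*-monoˡ-≤ (1 ^ suc r) (m≤m*n L (2 ^ suc r) {{m^n≢0 2 (suc r)}})))
  (begin
    h * 1 ^ (2 * r + 1)   ≡⟨ trans (cong (h *_) (^-zeroˡ (2 * r + 1))) (*-identityʳ h) ⟩
    h                     ≤⟨ minimal _ (deleteAll G k {{>-nonZero (≤-trans (s≤s z≤n) 2≤k)}}) ⟩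
    edgeCount G           ≤⟨ edgeCount-≤ G ⟩
    n * n                 ≤⟨ m≤n*m (n * n) 2 ⟩
    2 * (n * n)           ∎)
  where open ≤-Reasoning
... | yes enough = combine-bounds r L n k h (2 ^ t)
  (≤-trans (<⇒≤ k<next) (≤-reflexive next≡))
  (≤-trans (*-monoˡ-≤ ((2 ^ t) ^ (2 * r + 1)) h≤w) w≤)
  where
  open ≤-Reasoning

  colours : ℕ → ℕ
  colours t = L * (2 ^ t) ^ suc r

  fits? : ∀ t → Dec (colours t ≤ k)
  fits? t = colours t ≤? k

  t = largest fits? k

  t-fits : colours t ≤ k
  t-fits = largest-holds fits? enough k

  k<next : k < colours (suc t)
  -- The search up to `k` misses no candidate: if the palette of `suc t` fits, then `suc t` is
  -- itself at most `k`.
  k<next = ≰⇒> λ next-fits → 1+n≰n (≤largest fits? k (begin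
    suc t                      ≤⟨ <⇒≤ (n<2^n (suc t)) ⟩
    2 ^ suc t                  ≤⟨ m≤m^1+n (2 ^ suc t) r ⟩
    (2 ^ suc t) ^ suc r        ≤⟨ m≤n*m ((2 ^ suc t) ^ suc r) L ⟩
    colours (suc t)            ≤⟨ next-fits ⟩
    k                          ∎) next-fits)

  next≡ : colours (suc t) ≡ L * 2 ^ suc r * (2 ^ t) ^ suc r
  next≡ = trans (cong (L *_) (^-distribʳ-* (suc r) 2 (2 ^ t))) (sym (*-assoc L (2 ^ suc r) _))

  coloured = colouring G free t
    (≤-trans (m≤n*m ((2 ^ t) ^ suc r) L) (≤-trans t-fits k≤n))
  w = proj₁ coloured
  w≤ = proj₂ (proj₂ coloured)

  h≤w : h ≤ w
  h≤w with delete-clashes G (weaken t-fits (proj₁ (proj₂ coloured)))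
  ... | j , j≤w , deletable = ≤-trans (minimal j deletable) j≤w

-- Since (2 - 1/(r + 1))(r + 1) = 2r + 1, raising the inequality to the power `r + 1` and clearing
-- the denominator states it within the natural numbers.
theorem1p5 : ∀ (r : ℕ) → 1 ≤ r → ∃ λ (c : ℕ) → ∀ (n k : ℕ) → 2 ≤ k → k ≤ n →
    ∀ (h : ℕ) → Is-hₙ n k (wheel (2 * r + 1)) h →
    h ^ (r + 1) * k ^ (2 * r + 1) ≤ (c * n ^ 2) ^ (r + 1)
theorem1p5 r 1≤r = 2 * (suc (paletteFactor r (palette r)) * 2 ^ suc r) ^ (2 * r + 1) ,
  dyadic-colourings⇒bound (wheel (2 * r + 1)) r (suc (paletteFactor r (palette r)))
    λ G free → colour-all G r (palette r) 1≤r
      (*-mono-≤ (s≤s (z≤n {r})) (m^n>0 (suc (2 * r)) r)) (tree-colouring free)
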